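{- Let $G$ be a graph containing no induced triangle and no induced path on $5$ vertices. Then $\operatorname{reg}(G)$ equals the maximum, over all families $\{H_1,\dots,H_r\}$ of pairwise vertex-disjoint induced subgraphs of $G$ each isomorphic to $K_2$ or to the $5$-cycle $C_5$ and with no edges of $G$ between distinct $H_i$, of $(\#\{i:H_i\cong K_2\})+2(\#\{i:H_i\cong C_5\})$ (the empty family giving $0$).
   Context: $\operatorname{reg}(G)=\max\{j\ge0:\widetilde H_{j-1}(\operatorname{Ind}(G[S]);\Bbbk)\neq0\text{ for some }S\subseteq V(G)\}$ over a field $\Bbbk$, where $\operatorname{Ind}$ is the independence complex (regularity of $R/I(G)$ for the edge ideal). -}

module Defs where

open import Algebra.Apartness.Bundles using (HeytingField; module HeytingCommutativeRing)
open import Algebra.Bundles using (CommutativeRing)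
open import Data.Bool.Base using (if_then_else_)
open import Data.Fin.Base using (Fin; zero; suc; toℕ)
import Data.Fin.Properties as Fin
open import Data.Fin.Subset
  using (Subset; inside; outside; _∈_; _⊆_; _∩_; _∪_; ⁅_⁆; ∣_∣; Empty)
  renaming (⊥ to ∅)
open import Data.Fin.Subset.Properties using (_∈?_; ⊥⊆; ∉⊥; ⊆-trans)
open import Data.Nat.Base using (ℕ; zero; suc; _+_; _*_; _≤_; _%_)
import Data.Nat.Properties as ℕ
open import Data.Product.Base using (Σ-syntax; ∃-syntax; _×_; _,_; proj₁)
open import Data.Sum.Base using (_⊎_; [_,_]′; swap)
open import Data.Vec.Base using (_∷_; tabulate)
open import Function.Base using (_∘_; const)
open import Function.Bundles using (_↔_; _⇔_; module Inverse)
open import Level using (_⊔_; 0ℓ)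
open import Relation.Binary.Core using (Rel)
open import Relation.Binary.Definitions using (Decidable; Symmetric)
open import Relation.Binary.PropositionalEquality using (_≡_; _≢_; refl; sym)
open import Relation.Nullary using (¬_; does)
open import Relation.Nullary.Decidable using (¬?; _⊎-dec_; from-yes)

------------------------------------------------------------------------
-- Simple graphs

record Graph (V : Set) : Set₁ where
  field
    Adj    : Rel V 0ℓ
    irrefl : ∀ v → ¬ Adj v v
    symm   : Symmetric Adj
    adj?   : Decidable Adj

record _≅_ {V W : Set} (G : Graph V) (H : Graph W) : Set where
  field
    bijection : V ↔ W
    adj⇔      : ∀ u v → Graph.Adj G u v ⇔
                Graph.Adj H (Inverse.to bijection u) (Inverse.to bijection v)

-- The induced subgraph on S, with vertex type the elements of S.
_[_] : ∀ {n} → Graph (Fin n) → (S : Subset n) → Graph (Σ[ v ∈ Fin n ] v ∈ S)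
G [ S ] = record
  { Adj    = λ u v → Adj (proj₁ u) (proj₁ v)
  ; irrefl = λ v → irrefl (proj₁ v)
  ; symm   = symm
  ; adj?   = λ u v → adj? (proj₁ u) (proj₁ v)
  }
  where open Graph G

HasInduced : ∀ {n} {W : Set} → Graph (Fin n) → Graph W → Set
HasInduced {n} G H = ∃[ S ] (G [ S ]) ≅ H

K : ∀ m → Graph (Fin m)
K m = record
  { Adj    = _≢_
  ; irrefl = λ _ i≢i → i≢i refl
  ; symm   = λ i≢j j≡i → i≢j (sym j≡i)
  ; adj?   = λ i j → ¬? (i Fin.≟ j)
  }

-- The path on m vertices.
P : ∀ m → Graph (Fin m)
P m = record
  { Adj    = λ i j → suc (toℕ i) ≡ toℕ j ⊎ suc (toℕ j) ≡ toℕ i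
  ; irrefl = λ _ → [ ℕ.1+n≢n , ℕ.1+n≢n ]′
  ; symm   = swap
  ; adj?   = λ i j → (suc (toℕ i) ℕ.≟ toℕ j) ⊎-dec (suc (toℕ j) ℕ.≟ toℕ i)
  }

C₅ : Graph (Fin 5)
C₅ = record
  { Adj    = Adj
  ; irrefl = from-yes (Fin.all? λ i → ¬? (adj? i i))
  ; symm   = swap
  ; adj?   = adj?
  }
  where
  Adj : Rel (Fin 5) 0ℓ
  Adj i j = suc (toℕ i) % 5 ≡ toℕ j ⊎ suc (toℕ j) % 5 ≡ toℕ i

  adj? : Decidable Adj
  adj? i j = (suc (toℕ i) % 5 ℕ.≟ toℕ j) ⊎-dec (suc (toℕ j) % 5 ℕ.≟ toℕ i)

------------------------------------------------------------------------
-- Simplicial complexes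

-- The elements of Fin n need not all be vertices (singleton faces).
record SimplicialComplex (n : ℕ) : Set₁ where
  field
    IsFace     : Subset n → Set
    ∅-face     : IsFace ∅
    downClosed : ∀ {E F} → E ⊆ F → IsFace F → IsFace E

-- Ind[ G , S ] is the independence complex of G [ S ].
Ind[_,_] : ∀ {n} → Graph (Fin n) → Subset n → SimplicialComplex n
Ind[ G , S ] = record
  { IsFace     = λ F → F ⊆ S × (∀ {u v} → u ∈ F → v ∈ F → ¬ Graph.Adj G u v)
  ; ∅-face     = ⊥⊆ , λ u∈∅ _ _ → ∉⊥ u∈∅
  ; downClosed = λ E⊆F (F⊆S , indep) →
      ⊆-trans E⊆F F⊆S , λ u∈E v∈E → indep (E⊆F u∈E) (E⊆F v∈E)
  }

------------------------------------------------------------------------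
-- Reduced simplicial homology

-- The number of elements of F smaller than v.
position : ∀ {n} → Fin n → Subset n → ℕ
position zero    F             = 0
position (suc v) (inside  ∷ F) = suc (position v F)
position (suc v) (outside ∷ F) = position v F

module Homology {c ℓ} (R : CommutativeRing c ℓ) {n} (X : SimplicialComplex n) where

  open CommutativeRing R using (Carrier; _≈_; -_; 0#; +-monoid)
  open import Algebra.Properties.Monoid.Sum +-monoid using (sum)
  open SimplicialComplex X

  -- Chain j is the augmented oriented chain group in dimension j - 1: it is
  -- spanned by the faces with j elements, each oriented by the order of Fin n.
  -- In particular Chain 0 is spanned by ∅.
  record Chain (j : ℕ) : Set (c ⊔ ℓ) where
    field
      coeff     : Subset n → Carrier
      supported : ∀ F → ¬ (IsFace F × ∣ F ∣ ≡ j) → coeff F ≈ 0#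

  open Chain public

  -- (-1)ᵏ x
  signed : ℕ → Carrier → Carrier
  signed zero    x = x
  signed (suc k) x = - signed k x

  -- ∂ z F is the coefficient of F in the boundary of z.  From
  -- ∂ [v₀ < … < vₖ] = Σᵢ (-1)ⁱ [v₀ < … v̂ᵢ … < vₖ], the oriented face F ∪ {v}
  -- contributes with sign (-1)ⁱ, where i is the position of v in F ∪ {v}.
  ∂ : ∀ {j} → Chain j → Subset n → Carrier
  ∂ z F = sum λ v →
    if does (v ∈? F) then 0# else signed (position v F) (coeff z (F ∪ ⁅ v ⁆))

  IsCycle : ∀ {j} → Chain j → Set ℓ
  IsCycle z = ∀ F → ∂ z F ≈ 0#

  IsBoundary : ∀ {j} → Chain j → Set (c ⊔ ℓ)
  IsBoundary {j} z = Σ[ b ∈ Chain (suc j) ] (∀ F → ∂ b F ≈ coeff z F)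

  -- H̃ⱼ₋₁ (X; R) ≠ 0: the quotient of cycles by boundaries has a nonzero class.
  H̃[_-1]≢0 : ℕ → Set (c ⊔ ℓ)
  H̃[ j -1]≢0 = Σ[ z ∈ Chain j ] IsCycle z × ¬ IsBoundary z

------------------------------------------------------------------------
-- Regularity

IsMaximum : ∀ {ℓ} → (ℕ → Set ℓ) → ℕ → Set ℓ
IsMaximum Q m = Q m × (∀ {j} → Q j → j ≤ m)

-- A field is the library's HeytingField; classically the apartness is _≉_.
IsReg : ∀ {c ℓ₁ ℓ₂ n} → HeytingField c ℓ₁ ℓ₂ → Graph (Fin n) → ℕ → Set (c ⊔ ℓ₁)
IsReg 𝕜 G = IsMaximum λ j → ∃[ S ] Homology.H̃[_-1]≢0 R Ind[ G , S ] j
  where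
  open HeytingField 𝕜 using (heytingCommutativeRing)
  R = HeytingCommutativeRing.commutativeRing heytingCommutativeRing

------------------------------------------------------------------------
-- Families of induced edges and 5-cycles

record Family {n} (G : Graph (Fin n)) : Set where
  field
    r           : ℕ
    H           : Fin r → Subset n
    shape       : ∀ i → (G [ H i ]) ≅ K 2 ⊎ (G [ H i ]) ≅ C₅
    disjoint    : ∀ {i j} → i ≢ j → Empty (H i ∩ H j)
    nonadjacent : ∀ {i j} → i ≢ j → ∀ {u v} → u ∈ H i → v ∈ H j →
                  ¬ Graph.Adj G u v

  -- K 2 and C₅ are not isomorphic, so these do not depend on the choice of shape.
  #K₂ : ℕ
  #K₂ = ∣ tabulate ([ const inside , const outside ]′ ∘ shape) ∣

  #C₅ : ℕ
  #C₅ = ∣ tabulate ([ const outside , const inside ]′ ∘ shape) ∣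

  value : ℕ
  value = #K₂ + 2 * #C₅

IsFamilyValue : ∀ {n} → Graph (Fin n) → ℕ → Set
IsFamilyValue G m = Σ[ 𝓗 ∈ Family G ] Family.value 𝓗 ≡ m

{-# OPTIONS --safe #-}
module Submission where

-- Upper bound.  If N(u) ∩ S ⊆ N(v) ∩ S for distinct u, v in S, then deleting v
-- cannot lose homology: the link of v is a cone with apex u.  An isolated
-- vertex makes the whole complex a cone.  When neither applies, the vertices of
-- S have private neighbours against each other; without induced triangles and
-- 5-vertex paths, those of x and z close a path x y z up to a 5-cycle, and every
-- 5-cycle is a component.  So G [ S ] is a disjoint union of edges and
-- 5-cycles, and its independence complex has no faces with more elements than
-- the value of that family.
--
-- Lower bound.  On a disjoint union of edges and 5-cycles, the product of the
-- fundamental cycles of the factors (two points, resp. the complementary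
-- 5-cycle) is a nonzero cycle in top dimension, hence not a boundary.

open import Defs
open import Algebra.Apartness.Bundles using (HeytingField; module HeytingCommutativeRing)
import Algebra.Apartness.Properties.HeytingCommutativeRing as HeytingProperties
open import Algebra.Bundles using (CommutativeRing)
open import Data.Bool.Base using (if_then_else_)
open import Data.Empty using (⊥; ⊥-elim)
open import Data.Fin.Base as Fin using (Fin; zero; suc)
open import Data.Fin.Patterns using (0F; 1F; 2F; 3F; 4F)
open import Data.Fin.Properties using (_≟_; <-cmp; any?; all?)
open import Data.Fin.Subset hiding (⊤) renaming (⊥ to ∅; _-_ to _∖_)
open import Data.Fin.Subset.Induction using (⊂-wellFounded; Acc; acc)
open import Data.Fin.Subset.Properties
open import Data.Nat.Base as ℕ using (ℕ; zero; suc; _≤_; _<_; s≤s; s<s)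
import Data.Nat.Properties as ℕ
open import Data.Product.Base using (Σ-syntax; ∃-syntax; _×_; _,_; proj₁; proj₂)
open import Data.Sum.Base using (_⊎_; inj₁; inj₂; [_,_]′)
open import Data.Unit.Base using (⊤)
open import Data.Vec.Base using (lookup; tabulate; []; _∷_; here; there)
open import Data.Vec.Properties using (lookup∘tabulate; []=⇒lookup; lookup⇒[]=)
open import Data.Vec.Properties.WithK using ([]=-irrelevant)
open import Function.Base using (_∘_; const; id)
open import Function.Bundles using (Inverse; mk↔ₛ′; mk⇔; module Equivalence)
open import Level using (_⊔_)
open import Relation.Binary.Definitions using (tri<; tri≈; tri>)
open import Relation.Binary.PropositionalEquality as ≡ using (_≡_; _≢_)
open import Relation.Nullary
  using (¬_; Dec; yes; no; does; contradiction; ¬?; _×-dec_; _⊎-dec_; _→-dec_)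
open import Relation.Nullary.Decidable using (from-yes; from-no; dec-true; decidable-stable)
open import Relation.Unary using (Decidable)

private variable
  m n k : ℕ

-- Exterior algebra on the vertices and the simplicial boundary.

module Exterior {c ℓ} (R : CommutativeRing c ℓ) where

  open CommutativeRing R hiding (zero)
  open import Algebra.Properties.Ring ring using (-0#≈0#; -‿involutive)
  open import Algebra.Properties.AbelianGroup +-abelianGroup
    using () renaming (⁻¹-∙-comm to -‿+-comm)
  open import Algebra.Properties.Monoid.Sum +-monoid using (sum; sum-cong-≋)
  open import Algebra.Properties.CommutativeSemigroup
    (CommutativeRing.+-commutativeSemigroup R) using (interchange; x∙yz≈y∙xz)
  open import Relation.Binary.Reasoning.Setoid setoid

  -- F : Subset n stands for the increasing wedge product of its elements.  Then
  -- e v is left multiplication by v, ι v is contraction by the vector dual to v,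
  -- and δ, the boundary, is the sum of all ι v.
  Form : ℕ → Set c
  Form n = Subset n → Carrier

  infix 4 _≐_
  _≐_ : Form n → Form n → Set ℓ
  z ≐ w = ∀ F → z F ≈ w F

  e : Fin n → Form n → Form n
  e zero    z (inside  ∷ F) = z (outside ∷ F)
  e zero    z (outside ∷ F) = 0#
  e (suc v) z (inside  ∷ F) = - e v (z ∘ (inside ∷_)) F
  e (suc v) z (outside ∷ F) = e v (z ∘ (outside ∷_)) F

  ι : Fin n → Form n → Form n
  ι zero    z (inside  ∷ F) = 0#
  ι zero    z (outside ∷ F) = z (inside ∷ F)
  ι (suc v) z (inside  ∷ F) = - ι v (z ∘ (inside ∷_)) F
  ι (suc v) z (outside ∷ F) = ι v (z ∘ (outside ∷_)) F

  δ : Form n → Form n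
  δ z []            = 0#
  δ z (inside  ∷ F) = - δ (z ∘ (inside ∷_)) F
  δ z (outside ∷ F) = z (inside ∷ F) + δ (z ∘ (outside ∷_)) F

  -- Linearity

  record Linear (T : Form n → Form n) : Set (c ⊔ ℓ) where
    field
      cong    : ∀ {z w} → z ≐ w → T z ≐ T w
      homo-+  : ∀ z w F → T (λ E → z E + w E) F ≈ T z F + T w F
      homo--  : ∀ z F → T (λ E → - z E) F ≈ - T z F

    homo-0 : ∀ {z} → z ≐ (λ _ → 0#) → ∀ F → T z F ≈ 0#
    homo-0 {z} z≐0 F = begin
      T z F                                 ≈⟨ cong z≐z-z F ⟩
      T (λ E → z E - z E) F                 ≈⟨ homo-+ z (λ E → - z E) F ⟩
      T z F + T (λ E → - z E) F             ≈⟨ +-congˡ (homo-- z F) ⟩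
      T z F - T z F                         ≈⟨ -‿inverseʳ _ ⟩
      0#                                    ∎
      where
      z≐z-z : ∀ E → z E ≈ z E - z E
      z≐z-z E = trans (z≐0 E) (sym (-‿inverseʳ (z E)))

    homo-‿- : ∀ z w F → T (λ E → z E - w E) F ≈ T z F - T w F
    homo-‿- z w F = trans (homo-+ z _ F) (+-congˡ (homo-- w F))

  open Linear

  e-linear : ∀ (v : Fin n) → Linear (e v)
  e-linear v = record { cong = ≐-cong v ; homo-+ = +-homo v ; homo-- = neg-homo v }
    where
    ≐-cong : ∀ {n} (v : Fin n) {z w : Form n} → z ≐ w → e v z ≐ e v w
    ≐-cong zero    p (inside  ∷ F) = p (outside ∷ F)
    ≐-cong zero    p (outside ∷ F) = refl
    ≐-cong (suc v) p (inside  ∷ F) = -‿cong (≐-cong v (p ∘ (inside ∷_)) F)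
    ≐-cong (suc v) p (outside ∷ F) = ≐-cong v (p ∘ (outside ∷_)) F

    +-homo : ∀ {n} (v : Fin n) (z w : Form n) F → e v (λ E → z E + w E) F ≈ e v z F + e v w F
    +-homo zero    z w (inside  ∷ F) = refl
    +-homo zero    z w (outside ∷ F) = sym (+-identityˡ 0#)
    +-homo (suc v) z w (inside  ∷ F) = trans (-‿cong (+-homo v _ _ F)) (sym (-‿+-comm _ _))
    +-homo (suc v) z w (outside ∷ F) = +-homo v _ _ F

    neg-homo : ∀ {n} (v : Fin n) (z : Form n) F → e v (λ E → - z E) F ≈ - e v z F
    neg-homo zero    z (inside  ∷ F) = refl
    neg-homo zero    z (outside ∷ F) = sym -0#≈0#
    neg-homo (suc v) z (inside  ∷ F) = -‿cong (neg-homo v _ F)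
    neg-homo (suc v) z (outside ∷ F) = neg-homo v _ F

  ι-linear : ∀ (v : Fin n) → Linear (ι v)
  ι-linear v = record { cong = ≐-cong v ; homo-+ = +-homo v ; homo-- = neg-homo v }
    where
    ≐-cong : ∀ {n} (v : Fin n) {z w : Form n} → z ≐ w → ι v z ≐ ι v w
    ≐-cong zero    p (inside  ∷ F) = refl
    ≐-cong zero    p (outside ∷ F) = p (inside ∷ F)
    ≐-cong (suc v) p (inside  ∷ F) = -‿cong (≐-cong v (p ∘ (inside ∷_)) F)
    ≐-cong (suc v) p (outside ∷ F) = ≐-cong v (p ∘ (outside ∷_)) F

    +-homo : ∀ {n} (v : Fin n) (z w : Form n) F → ι v (λ E → z E + w E) F ≈ ι v z F + ι v w F
    +-homo zero    z w (inside  ∷ F) = sym (+-identityˡ 0#)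
    +-homo zero    z w (outside ∷ F) = refl
    +-homo (suc v) z w (inside  ∷ F) = trans (-‿cong (+-homo v _ _ F)) (sym (-‿+-comm _ _))
    +-homo (suc v) z w (outside ∷ F) = +-homo v _ _ F

    neg-homo : ∀ {n} (v : Fin n) (z : Form n) F → ι v (λ E → - z E) F ≈ - ι v z F
    neg-homo zero    z (inside  ∷ F) = sym -0#≈0#
    neg-homo zero    z (outside ∷ F) = refl
    neg-homo (suc v) z (inside  ∷ F) = -‿cong (neg-homo v _ F)
    neg-homo (suc v) z (outside ∷ F) = neg-homo v _ F

  δ-linear : Linear (δ {n})
  δ-linear = record { cong = ≐-cong ; homo-+ = +-homo ; homo-- = neg-homo }
    where
    ≐-cong : ∀ {n} {z w : Form n} → z ≐ w → δ z ≐ δ w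
    ≐-cong p []            = refl
    ≐-cong p (inside  ∷ F) = -‿cong (≐-cong (p ∘ (inside ∷_)) F)
    ≐-cong p (outside ∷ F) = +-cong (p (inside ∷ F)) (≐-cong (p ∘ (outside ∷_)) F)

    +-homo : ∀ {n} (z w : Form n) F → δ (λ E → z E + w E) F ≈ δ z F + δ w F
    +-homo z w []            = sym (+-identityˡ 0#)
    +-homo z w (inside  ∷ F) = trans (-‿cong (+-homo _ _ F)) (sym (-‿+-comm _ _))
    +-homo z w (outside ∷ F) = trans (+-congˡ (+-homo _ _ F)) (interchange _ _ _ _)

    neg-homo : ∀ {n} (z : Form n) F → δ (λ E → - z E) F ≈ - δ z F
    neg-homo z []            = sym -0#≈0#
    neg-homo z (inside  ∷ F) = -‿cong (neg-homo _ F)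
    neg-homo z (outside ∷ F) = trans (+-congˡ (neg-homo _ F)) (-‿+-comm _ _)

  -- Commutation relations

  -- The boundary is an antiderivation that sends the vertex `v` to 1. For a cycle `z` the last term
  -- drops out, so `e v z` is a cone with boundary `z`.
  δ-e : ∀ (v : Fin n) z F → δ (e v z) F ≈ z F - e v (δ z) F
  δ-e zero z (inside ∷ F) = sym (begin
    z (inside ∷ F) - (z (inside ∷ F) + d)      ≈⟨ +-congˡ (-‿+-comm _ _) ⟨
    z (inside ∷ F) + (- z (inside ∷ F) + - d)  ≈⟨ +-assoc _ _ _ ⟨
    (z (inside ∷ F) - z (inside ∷ F)) + - d    ≈⟨ +-congʳ (-‿inverseʳ _) ⟩
    0# + - d                                   ≈⟨ +-identityˡ _ ⟩
    - d                                        ∎)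
    where d = δ (z ∘ (outside ∷_)) F
  δ-e zero z (outside ∷ F) =
    +-congˡ (trans (homo-0 δ-linear (λ _ → refl) F) (sym -0#≈0#))
  δ-e (suc v) z (inside ∷ F) = begin
    - δ (λ E → - e v (z ∘ (inside ∷_)) E) F            ≈⟨ -‿cong (homo-- δ-linear _ F) ⟩
    - - δ (e v (z ∘ (inside ∷_))) F                    ≈⟨ -‿involutive _ ⟩
    δ (e v (z ∘ (inside ∷_))) F                        ≈⟨ δ-e v _ F ⟩
    z (inside ∷ F) - e v (δ (z ∘ (inside ∷_))) F       ≈⟨ +-congˡ (-‿involutive _) ⟨
    z (inside ∷ F) - - - e v (δ (z ∘ (inside ∷_))) F
      ≈⟨ +-congˡ (-‿cong (-‿cong (homo-- (e-linear v) _ F))) ⟨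
    z (inside ∷ F) - - e v (λ E → - δ (z ∘ (inside ∷_)) E) F ∎
  δ-e (suc v) z (outside ∷ F) = begin
    - e v (z ∘ (inside ∷_)) F + δ (e v (z ∘ (outside ∷_))) F  ≈⟨ +-congˡ (δ-e v _ F) ⟩
    - e v (z ∘ (inside ∷_)) F + (z (outside ∷ F) - e v (δ (z ∘ (outside ∷_))) F)
      ≈⟨ x∙yz≈y∙xz _ _ _ ⟩
    z (outside ∷ F) + (- e v (z ∘ (inside ∷_)) F - e v (δ (z ∘ (outside ∷_))) F)
      ≈⟨ +-congˡ (-‿+-comm _ _) ⟩
    z (outside ∷ F) - (e v (z ∘ (inside ∷_)) F + e v (δ (z ∘ (outside ∷_))) F)
      ≈⟨ +-congˡ (-‿cong (homo-+ (e-linear v) _ _ F)) ⟨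
    z (outside ∷ F) - e v (δ z ∘ (outside ∷_)) F ∎

  -- Contractions anticommute and `δ` is a sum of contractions. Hence the link part `ι v z` of a
  -- cycle is again a cycle.
  δ-ι : ∀ (v : Fin n) z F → δ (ι v z) F ≈ - ι v (δ z) F
  δ-ι zero z (inside  ∷ F) = -‿cong (homo-0 δ-linear (λ _ → refl) F)
  δ-ι zero z (outside ∷ F) = trans (+-identityˡ _) (sym (-‿involutive _))
  δ-ι (suc v) z (inside ∷ F) = -‿cong (begin
    δ (λ E → - ι v (z ∘ (inside ∷_)) E) F    ≈⟨ homo-- δ-linear _ F ⟩
    - δ (ι v (z ∘ (inside ∷_))) F            ≈⟨ -‿cong (δ-ι v _ F) ⟩
    - - ι v (δ (z ∘ (inside ∷_))) F          ≈⟨ -‿cong (homo-- (ι-linear v) _ F) ⟨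
    - ι v (λ E → - δ (z ∘ (inside ∷_)) E) F  ∎)
  δ-ι (suc v) z (outside ∷ F) = begin
    - ι v (z ∘ (inside ∷_)) F + δ (ι v (z ∘ (outside ∷_))) F    ≈⟨ +-congˡ (δ-ι v _ F) ⟩
    - ι v (z ∘ (inside ∷_)) F - ι v (δ (z ∘ (outside ∷_))) F    ≈⟨ -‿+-comm _ _ ⟩
    - (ι v (z ∘ (inside ∷_)) F + ι v (δ (z ∘ (outside ∷_))) F)
      ≈⟨ -‿cong (homo-+ (ι-linear v) _ _ F) ⟨
    - ι v (δ z ∘ (outside ∷_)) F ∎

  -- Contraction takes `v` out and multiplication puts it back past the same elements, so the two
  -- signs cancel.
  e-ι : ∀ {v : Fin n} z {F} → v ∈ F → e v (ι v z) F ≈ z F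
  e-ι z here                        = refl
  e-ι {v = suc v} z {inside ∷ F} (there v∈F) = begin
    - e v (λ E → - ι v (z ∘ (inside ∷_)) E) F  ≈⟨ -‿cong (homo-- (e-linear v) _ F) ⟩
    - - e v (ι v (z ∘ (inside ∷_))) F          ≈⟨ -‿involutive _ ⟩
    e v (ι v (z ∘ (inside ∷_))) F              ≈⟨ e-ι _ v∈F ⟩
    z (inside ∷ F)                             ∎
  e-ι {v = suc v} z {outside ∷ F} (there v∈F) = e-ι _ v∈F

  -- Supports

  -x≈0 : ∀ {x} → x ≈ 0# → - x ≈ 0#
  -x≈0 x≈0 = trans (-‿cong x≈0) -0#≈0#

  -x≈0⁻ : ∀ {x} → - x ≈ 0# → x ≈ 0#
  -x≈0⁻ -x≈0′ = trans (sym (-‿involutive _)) (-x≈0 -x≈0′)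

  e-∉ : ∀ (v : Fin n) z {F} → v ∉ F → e v z F ≈ 0#
  e-∉ zero    z {inside  ∷ F} v∉F = contradiction here v∉F
  e-∉ zero    z {outside ∷ F} v∉F = refl
  e-∉ (suc v) z {inside  ∷ F} v∉F = -x≈0 (e-∉ v _ (v∉F ∘ there))
  e-∉ (suc v) z {outside ∷ F} v∉F = e-∉ v _ (v∉F ∘ there)

  -- For `v` in `F` the coefficient is, up to sign, that of `z` at `F` without `v`. Speaking of
  -- vanishing alone keeps the sign out of the statement, as in `e-∪` and `ι-∪`.
  e-∈ : ∀ (v : Fin n) z F → z (F ∖ v) ≈ 0# → e v z F ≈ 0#
  e-∈ zero    z (inside  ∷ F) p = ≡.subst (λ E → z (outside ∷ E) ≈ 0#) (p─⊥≡p F) p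
  e-∈ zero    z (outside ∷ F) p = refl
  e-∈ (suc v) z (inside  ∷ F) p = -x≈0 (e-∈ v _ F p)
  e-∈ (suc v) z (outside ∷ F) p = e-∈ v _ F p

  -- The coefficient at the enlarged set is `± z F`, so multiplication by `v` loses nothing on sets
  -- avoiding `v`. This is how the fundamental cycles are seen to be nonzero.
  e-∪ : ∀ (v : Fin n) z F → v ∉ F → e v z (F ∪ ⁅ v ⁆) ≈ 0# → z F ≈ 0#
  e-∪ zero    z (inside  ∷ F) v∉F p = contradiction here v∉F
  e-∪ zero    z (outside ∷ F) v∉F p =
    ≡.subst (λ E → z (outside ∷ E) ≈ 0#) (∪-identityʳ F) p
  e-∪ (suc v) z (inside  ∷ F) v∉F p = e-∪ v _ F (v∉F ∘ there) (-x≈0⁻ p)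
  e-∪ (suc v) z (outside ∷ F) v∉F p = e-∪ v _ F (v∉F ∘ there) p

  ι-∈ : ∀ (v : Fin n) z {F} → v ∈ F → ι v z F ≈ 0#
  ι-∈ zero    z here                      = refl
  ι-∈ (suc v) z {inside  ∷ F} (there v∈F) = -x≈0 (ι-∈ v _ v∈F)
  ι-∈ (suc v) z {outside ∷ F} (there v∈F) = ι-∈ v _ v∈F

  ι-∪ : ∀ (v : Fin n) z F → z (F ∪ ⁅ v ⁆) ≈ 0# → ι v z F ≈ 0#
  ι-∪ zero    z (inside  ∷ F) p = refl
  ι-∪ zero    z (outside ∷ F) p = ≡.subst (λ E → z (inside ∷ E) ≈ 0#) (∪-identityʳ F) p
  ι-∪ (suc v) z (inside  ∷ F) p = -x≈0 (ι-∪ v _ F p)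
  ι-∪ (suc v) z (outside ∷ F) p = ι-∪ v _ F p

  -- Phrased as vanishing outside `P`, like the field `supported` of a chain, so that `P` need not
  -- be decided.
  Supp : ∀ {p} → (Subset n → Set p) → Form n → Set (p ⊔ ℓ)
  Supp P z = ∀ F → ¬ P F → z F ≈ 0#

  e-supp : ∀ {p q} {P : Subset n → Set p} {Q : Subset n → Set q} v {z} →
           (∀ {F} → v ∈ F → P (F ∖ v) → Q F) → Supp P z → Supp Q (e v z)
  e-supp v P⇒Q supp F ¬QF with v ∈? F
  ... | yes v∈F = e-∈ v _ F (supp _ (¬QF ∘ P⇒Q v∈F))
  ... | no  v∉F = e-∉ v _ v∉F

  ι-supp : ∀ {p q} {P : Subset n → Set p} {Q : Subset n → Set q} v {z} →
           (∀ {F} → v ∉ F → P (F ∪ ⁅ v ⁆) → Q F) → Supp P z → Supp Q (ι v z)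
  ι-supp v P⇒Q supp F ¬QF with v ∈? F
  ... | yes v∈F = ι-∈ v _ v∈F
  ... | no  v∉F = ι-∪ v _ F (supp _ (¬QF ∘ P⇒Q v∉F))

  -- Comparison with the simplicial boundary

  sum-neg : ∀ {n} (f : Fin n → Carrier) → sum (λ v → - f v) ≈ - sum f
  sum-neg {zero}  f = sym -0#≈0#
  sum-neg {suc n} f = trans (+-congˡ (sum-neg (f ∘ suc))) (-‿+-comm _ _)

  private
    -- Homology.signed takes the complex, hence n, as a parameter, which blocks
    -- induction on n.
    signed : ℕ → Carrier → Carrier
    signed zero    x = x
    signed (suc k) x = - signed k x

    term : Form n → Subset n → Fin n → Carrier
    term z F v = if does (v ∈? F) then 0# else signed (position v F) (z (F ∪ ⁅ v ⁆))

  -- Both sides flip sign once for each element of `F` below `v`: `position` counts these elements,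
  -- and `ι` negates at each `inside` it passes.
  term≈ι : ∀ (z : Form n) F v → term z F v ≈ ι v z F
  term≈ι z (inside  ∷ F) zero = refl
  term≈ι z (outside ∷ F) zero = reflexive (≡.cong (z ∘ (inside ∷_)) (∪-identityʳ F))
  term≈ι z (outside ∷ F) (suc v) = term≈ι (z ∘ (outside ∷_)) F v
  term≈ι z (inside  ∷ F) (suc v) with does (v ∈? F) | term≈ι (z ∘ (inside ∷_)) F v
  ... | inside  | p = trans (sym -0#≈0#) (-‿cong p)
  ... | outside | p = -‿cong p

  sum-ι : ∀ (z : Form n) F → sum (λ v → ι v z F) ≈ δ z F
  sum-ι z []            = refl
  sum-ι z (inside  ∷ F) = trans (+-identityˡ _)
    (trans (sum-neg (λ v → ι v (z ∘ (inside ∷_)) F)) (-‿cong (sum-ι _ F)))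
  sum-ι z (outside ∷ F) = +-congˡ (sum-ι _ F)

  module _ (X : SimplicialComplex n) where
    open Homology R X renaming (signed to signedₓ)

    signedₓ≈signed : ∀ k x → signedₓ k x ≈ signed k x
    signedₓ≈signed zero    x = refl
    signedₓ≈signed (suc k) x = -‿cong (signedₓ≈signed k x)

    ∂≈δ : ∀ {j} (z : Chain j) F → ∂ z F ≈ δ (coeff z) F
    ∂≈δ z F = trans
      (sum-cong-≋ λ v → trans (branch v (does (v ∈? F))) (term≈ι (coeff z) F v))
      (sum-ι (coeff z) F)
      where
      branch : ∀ v b → (if b then 0# else signedₓ (position v F) (coeff z (F ∪ ⁅ v ⁆)))
                     ≈ (if b then 0# else signed (position v F) (coeff z (F ∪ ⁅ v ⁆)))
      branch v inside  = refl
      branch v outside = signedₓ≈signed (position v F) _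

-- Induced copies

separate : {P : Fin n → Set} → Decidable P → Subset n
separate P? = tabulate (does ∘ P?)

module _ {P : Fin n → Set} (P? : Decidable P) where

  ∈-separate⁺ : ∀ {v} → P v → v ∈ separate P?
  ∈-separate⁺ {v} pv = lookup⇒[]= v _ (≡.trans (lookup∘tabulate _ v) (dec-true (P? v) pv))

  ∈-separate⁻ : ∀ {v} → v ∈ separate P? → P v
  ∈-separate⁻ {v} v∈ with P? v | ≡.trans (≡.sym (lookup∘tabulate (does ∘ P?) v)) ([]=⇒lookup v∈)
  ... | yes pv | _ = pv

module _ (f : Fin m → Fin n) where

  ∈image? : Decidable (λ v → ∃[ i ] f i ≡ v)
  ∈image? v = any? λ i → f i ≟ v

  image : Subset n
  image = separate ∈image?

  ∈-image : ∀ i → f i ∈ image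
  ∈-image i = ∈-separate⁺ ∈image? (i , ≡.refl)

∈-Σ-≡ : ∀ {S : Subset n} {u v : Σ[ v ∈ Fin n ] v ∈ S} → proj₁ u ≡ proj₁ v → u ≡ v
∈-Σ-≡ {u = _ , p} {_ , q} ≡.refl = ≡.cong (_ ,_) ([]=-irrelevant p q)

-- An induced subgraph isomorphic to `H`, given as an embedding: its vertices are named by indices
-- rather than found inside a subset.
record Copy (G : Graph (Fin n)) (H : Graph (Fin m)) : Set where
  field
    to        : Fin m → Fin n
    injective : ∀ {i j} → to i ≡ to j → i ≡ j
    adj⁺      : ∀ {i j} → Graph.Adj H i j → Graph.Adj G (to i) (to j)
    adj⁻      : ∀ {i j} → Graph.Adj G (to i) (to j) → Graph.Adj H i j

open Copy

module _ {G : Graph (Fin n)} {H : Graph (Fin m)} where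

  copy⇒≅ : (c : Copy G H) → (G [ image (to c) ]) ≅ H
  copy⇒≅ c = record
    { bijection = mk↔ₛ′ (proj₁ ∘ index) (λ i → to c i , ∈-image (to c) i)
        (λ i → injective c (proj₂ (index (to c i , ∈-image (to c) i))))
        (λ v → ∈-Σ-≡ (proj₂ (index v)))
    ; adj⇔ = λ u v → mk⇔
        (λ uv → adj⁻ c
          (≡.subst₂ (Graph.Adj G) (≡.sym (proj₂ (index u))) (≡.sym (proj₂ (index v))) uv))
        (λ uv → ≡.subst₂ (Graph.Adj G) (proj₂ (index u)) (proj₂ (index v)) (adj⁺ c uv))
    }
    where
    index : ((v , _) : Σ[ v ∈ Fin n ] v ∈ image (to c)) → ∃[ i ] to c i ≡ v
    index (_ , v∈) = ∈-separate⁻ (∈image? (to c)) v∈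

  ≅⇒copy : ∀ {S} → (G [ S ]) ≅ H → Copy G H
  ≅⇒copy G[S]≅H = record
    { to        = proj₁ ∘ from
    ; injective = λ {i} {j} p → ≡.trans (≡.sym (strictlyInverseˡ i))
        (≡.trans (≡.cong Inv.to (∈-Σ-≡ p)) (strictlyInverseˡ j))
    ; adj⁺      = λ {i} {j} ij → Equivalence.from (_≅_.adj⇔ G[S]≅H (from i) (from j))
        (≡.subst₂ (Graph.Adj H) (≡.sym (strictlyInverseˡ i)) (≡.sym (strictlyInverseˡ j)) ij)
    ; adj⁻      = λ {i} {j} ij → ≡.subst₂ (Graph.Adj H) (strictlyInverseˡ i) (strictlyInverseˡ j)
        (Equivalence.to (_≅_.adj⇔ G[S]≅H (from i) (from j)) ij)
    }
    where
    module Inv = Inverse (_≅_.bijection G[S]≅H)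
    open Inv using (from; strictlyInverseˡ)

  ≅⇒copy-∈ : ∀ {S} (φ : (G [ S ]) ≅ H) i → to (≅⇒copy φ) i ∈ S
  ≅⇒copy-∈ φ i = proj₂ (Inverse.from (_≅_.bijection φ) i)

  ≅⇒copy-onto : ∀ {S} (φ : (G [ S ]) ≅ H) {v} → v ∈ S → ∃[ i ] to (≅⇒copy φ) i ≡ v
  ≅⇒copy-onto φ v∈ = _ , ≡.cong proj₁ (Inverse.strictlyInverseʳ (_≅_.bijection φ) (_ , v∈))

∀Fin : ∀ m → (Fin m → Set) → Set
∀Fin zero    P = ⊤
∀Fin (suc m) P = P zero × ∀Fin m (P ∘ suc)

-- A relation on the pairs i < j, as nested tuples: for a literal m its proof can
-- be written out as a triangular table.
∀Pairs : ∀ m → (Fin m → Fin m → Set) → Set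
∀Pairs zero    R = ⊤
∀Pairs (suc m) R = ∀Fin m (R zero ∘ suc) × ∀Pairs m (λ i j → R (suc i) (suc j))

∀Fin-lookup : {P : Fin m → Set} → ∀Fin m P → ∀ i → P i
∀Fin-lookup (p , _)  zero    = p
∀Fin-lookup (_ , ps) (suc i) = ∀Fin-lookup ps i

∀Pairs-lookup : {R : Fin m → Fin m → Set} → ∀Pairs m R → ∀ {i j} → i Fin.< j → R i j
∀Pairs-lookup (r , _)  {zero}  {suc j} _         = ∀Fin-lookup r j
∀Pairs-lookup (_ , rs) {suc i} {suc j} (s<s i<j) = ∀Pairs-lookup rs i<j

-- A map out of such a graph that preserves and reflects adjacency is automatically injective, since
-- vertices with equal images have the same neighbours. Copies can thus be built from adjacencies
-- alone.
TwinFree : Graph (Fin m) → Set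
TwinFree H = ∀ i j → (∀ k → Adj k i → Adj k j) → (∀ k → Adj k j → Adj k i) → i ≡ j
  where open Graph H

twinFree? : (H : Graph (Fin m)) → Dec (TwinFree H)
twinFree? H = all? λ i → all? λ j →
  (all? λ k → adj? k i →-dec adj? k j) →-dec (all? λ k → adj? k j →-dec adj? k i) →-dec (i ≟ j)
  where open Graph H

module _ (G : Graph (Fin n)) (H : Graph (Fin m)) (f : Fin m → Fin n) where

  -- For a concrete `H` and literal indices the `if` computes, so each entry of the table is a plain
  -- adjacency or nonadjacency in `G`.
  SameAdj : Fin m → Fin m → Set
  SameAdj i j =
    if does (Graph.adj? H i j) then Graph.Adj G (f i) (f j) else ¬ Graph.Adj G (f i) (f j)

  mkCopy : TwinFree H → ∀Pairs m SameAdj → Copy G H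
  mkCopy tf pairs = record
    { to        = f
    ; injective = λ {i} {j} p → tf i j
        (λ k ki → ⁻ (≡.subst (Graph.Adj G (f k)) p (⁺ ki)))
        (λ k kj → ⁻ (≡.subst (Graph.Adj G (f k)) (≡.sym p) (⁺ kj)))
    ; adj⁺      = ⁺
    ; adj⁻      = ⁻
    }
    where
    module G = Graph G
    module H = Graph H

    same⁺ : ∀ {i j} → SameAdj i j → H.Adj i j → G.Adj (f i) (f j)
    same⁺ {i} {j} s ij with H.adj? i j
    ... | yes _ = s
    ... | no ¬ij = contradiction ij ¬ij

    same⁻ : ∀ {i j} → SameAdj i j → G.Adj (f i) (f j) → H.Adj i j
    same⁻ {i} {j} s ij with H.adj? i j
    ... | yes p = p
    ... | no _  = contradiction ij s

    ⁺ : ∀ {i j} → H.Adj i j → G.Adj (f i) (f j)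
    ⁺ {i} {j} ij with <-cmp i j
    ... | tri< i<j _ _  = same⁺ (∀Pairs-lookup pairs i<j) ij
    ... | tri≈ _ ≡.refl _ = contradiction ij (H.irrefl i)
    ... | tri> _ _ j<i  = G.symm (same⁺ (∀Pairs-lookup pairs j<i) (H.symm ij))

    ⁻ : ∀ {i j} → G.Adj (f i) (f j) → H.Adj i j
    ⁻ {i} {j} ij with <-cmp i j
    ... | tri< i<j _ _  = same⁻ (∀Pairs-lookup pairs i<j) ij
    ... | tri≈ _ ≡.refl _ = contradiction ij (G.irrefl (f i))
    ... | tri> _ _ j<i  = H.symm (same⁻ (∀Pairs-lookup pairs j<i) (G.symm ij))

-- Disjoint unions of induced edges and 5-cycles

data Shape : Set where
  edge pentagon : Shape

order weight : Shape → ℕ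
order edge     = 2
order pentagon = 5
weight edge     = 1
weight pentagon = 2

graph : ∀ s → Graph (Fin (order s))
graph edge     = K 2
graph pentagon = C₅

module Decomposition (G : Graph (Fin n)) where
  open Graph G

  -- A splitting of `G [ U ]` into components that are edges or 5-cycles, listed one at a time; the
  -- index is the value of the resulting family. In `join`, `T` is what remains of `U` without the
  -- copy.
  data Decomp : Subset n → ℕ → Set where
    empty : ∀ {U} → Empty U → Decomp U 0
    join  : ∀ {T U} s (c : Copy G (graph s)) → T ⊆ U → (∀ i → to c i ∈ U) →
            (∀ {x} → x ∈ U → x ∈ T ⊎ ∃[ i ] to c i ≡ x) →
            (∀ i → to c i ∉ T) →
            (∀ i {x} → x ∈ T → ¬ Adj (to c i) x) →
            Decomp T k → Decomp U (weight s ℕ.+ k)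

  +-2* : ∀ a b → a ℕ.+ 2 ℕ.* suc b ≡ 2 ℕ.+ (a ℕ.+ 2 ℕ.* b)
  +-2* a b = ≡.trans (≡.cong (a ℕ.+_) (ℕ.*-suc 2 b)) (≡.trans (≡.sym (ℕ.+-assoc a 2 (2 ℕ.* b)))
    (≡.cong (ℕ._+ 2 ℕ.* b) (ℕ.+-comm a 2)))

  -- The inclusions in `U` are carried along because a new component is known to be disjoint from
  -- and nonadjacent to `T` as a whole, not to the individual members of the family.
  decomp⇒family : ∀ {U} → Decomp U k →
                  Σ[ 𝓗 ∈ Family G ] Family.value 𝓗 ≡ k × (∀ i → Family.H 𝓗 i ⊆ U)
  decomp⇒family (empty _) = record
    { r = 0 ; H = λ () ; shape = λ () ; disjoint = λ { {()} } ; nonadjacent = λ { {()} } }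
    , ≡.refl , λ ()
  decomp⇒family {U = U} (join {k = k} {T = T} s c T⊆U c∈U cover c∉T c≁T D)
    with decomp⇒family D
  ... | 𝓗 , ≡.refl , H⊆T = 𝓗′ , value′ s c , H⊆U
    where
    open Family 𝓗

    fromImage : ∀ {P : Fin n → Set} → (∀ i → P (to c i)) → ∀ {x} → x ∈ image (to c) → P x
    fromImage {P} p x∈ with ∈-separate⁻ (∈image? (to c)) x∈
    ... | i , ≡.refl = p i

    H′ : Fin (suc r) → Subset n
    H′ zero    = image (to c)
    H′ (suc i) = H i

    shape-of : ∀ s (c : Copy G (graph s)) → (G [ image (to c) ]) ≅ K 2 ⊎ (G [ image (to c) ]) ≅ C₅
    shape-of edge     c = inj₁ (copy⇒≅ c)
    shape-of pentagon c = inj₂ (copy⇒≅ c)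

    shape′ : ∀ i → (G [ H′ i ]) ≅ K 2 ⊎ (G [ H′ i ]) ≅ C₅
    shape′ zero    = shape-of s c
    shape′ (suc i) = shape i

    disjoint′ : ∀ {i j} → i ≢ j → Empty (H′ i ∩ H′ j)
    disjoint′ {zero}  {zero}  i≢j _ = i≢j ≡.refl
    disjoint′ {suc i} {suc j} i≢j x = disjoint (i≢j ∘ ≡.cong suc) x
    disjoint′ {zero}  {suc j} _ (x , x∈) with x∈p∩q⁻ (image (to c)) (H j) x∈
    ... | x∈c , x∈H = fromImage {λ x → x ∉ T} c∉T x∈c (H⊆T j x∈H)
    disjoint′ {suc i} {zero}  _ (x , x∈) with x∈p∩q⁻ (H i) (image (to c)) x∈
    ... | x∈H , x∈c = fromImage {λ x → x ∉ T} c∉T x∈c (H⊆T i x∈H)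

    nonadjacent′ : ∀ {i j} → i ≢ j → ∀ {u v} → u ∈ H′ i → v ∈ H′ j → ¬ Adj u v
    nonadjacent′ {zero}  {zero}  i≢j = contradiction ≡.refl i≢j
    nonadjacent′ {suc i} {suc j} i≢j = nonadjacent (i≢j ∘ ≡.cong suc)
    nonadjacent′ {zero}  {suc j} _ {v = v} u∈ v∈ =
      fromImage {λ u → ¬ Adj u v} (λ i → c≁T i (H⊆T j v∈)) u∈
    nonadjacent′ {suc i} {zero}  _ {u = u} u∈ v∈ uv =
      fromImage {λ v → ¬ Adj v u} (λ j → c≁T j (H⊆T i u∈)) v∈ (symm uv)

    𝓗′ : Family G
    𝓗′ = record { r = suc r ; H = H′ ; shape = shape′
                ; disjoint = disjoint′ ; nonadjacent = nonadjacent′ }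

    value′ : ∀ s (c : Copy G (graph s)) →
      let shapes = shape-of s c in
      ∣ [ const inside , const outside ]′ shapes
        ∷ tabulate ([ const inside , const outside ]′ ∘ shape) ∣
      ℕ.+ 2 ℕ.* ∣ [ const outside , const inside ]′ shapes
                  ∷ tabulate ([ const outside , const inside ]′ ∘ shape) ∣
      ≡ weight s ℕ.+ value
    value′ edge     c = ≡.refl
    value′ pentagon c = +-2* #K₂ #C₅

    H⊆U : ∀ i → H′ i ⊆ U
    H⊆U zero    = fromImage c∈U
    H⊆U (suc i) = T⊆U ∘ H⊆T i

  -- The fields of the family are separate arguments so that recursion on `r` can pass to the tail.
  -- The last conclusion turns the pairwise conditions into conditions between the first member and
  -- the union of the others.
  family⇒decomp : ∀ r (H : Fin r → Subset n)
    (shape : ∀ i → (G [ H i ]) ≅ K 2 ⊎ (G [ H i ]) ≅ C₅)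
    (disjoint : ∀ {i j} → i ≢ j → Empty (H i ∩ H j))
    (nonadjacent : ∀ {i j} → i ≢ j → ∀ {u v} → u ∈ H i → v ∈ H j → ¬ Adj u v) →
    ∃[ U ] Decomp U (Family.value {G = G} (record { r = r ; H = H ; shape = shape
      ; disjoint = disjoint ; nonadjacent = nonadjacent }))
      × (∀ {x} → x ∈ U → ∃[ i ] x ∈ H i)
  family⇒decomp zero H shape disjoint nonadjacent =
    ∅ , empty (∉⊥ ∘ proj₂) , λ x∈ → contradiction x∈ ∉⊥
  family⇒decomp (suc r) H shape disjoint nonadjacent
    with family⇒decomp r (H ∘ suc) (shape ∘ suc)
           (λ i≢j → disjoint (λ { ≡.refl → i≢j ≡.refl }))
           (λ i≢j → nonadjacent (λ { ≡.refl → i≢j ≡.refl }))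
  ... | T , D , T⊆H = T ∪ H zero , addShape (shape zero)
      (tabulate ([ const inside , const outside ]′ ∘ shape ∘ suc))
      (tabulate ([ const outside , const inside ]′ ∘ shape ∘ suc)) D , covered
    where
    covered : ∀ {x} → x ∈ T ∪ H zero → ∃[ i ] x ∈ H i
    covered x∈ with x∈p∪q⁻ T (H zero) x∈
    ... | inj₁ x∈T = suc (proj₁ (T⊆H x∈T)) , proj₂ (T⊆H x∈T)
    ... | inj₂ x∈H = zero , x∈H

    H∉T : ∀ {x} → x ∈ H zero → x ∉ T
    H∉T {x} x∈H x∈T =
      disjoint {zero} {suc (proj₁ (T⊆H x∈T))} (λ ()) (x , x∈p∩q⁺ (x∈H , proj₂ (T⊆H x∈T)))

    H≁T : ∀ {x y} → x ∈ H zero → y ∈ T → ¬ Adj x y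
    H≁T x∈H y∈T = nonadjacent (λ ()) x∈H (proj₂ (T⊆H y∈T))

    add : ∀ s → (G [ H zero ]) ≅ graph s → ∀ {k} → Decomp T k → Decomp (T ∪ H zero) (weight s ℕ.+ k)
    add s φ = join s (≅⇒copy φ) (p⊆p∪q (H zero))
      (λ i → q⊆p∪q T (H zero) (≅⇒copy-∈ φ i))
      (λ x∈ → [ inj₁ , inj₂ ∘ ≅⇒copy-onto φ ]′ (x∈p∪q⁻ T (H zero) x∈))
      (λ i → H∉T (≅⇒copy-∈ φ i))
      (λ i → H≁T (≅⇒copy-∈ φ i))

    -- The counts of the tail are generalised to `p` and `q`, so that matching on the shape
    -- evaluates the new head of both.
    addShape : ∀ (σ : (G [ H zero ]) ≅ K 2 ⊎ (G [ H zero ]) ≅ C₅) {r} (p q : Subset r) →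
      Decomp T (∣ p ∣ ℕ.+ 2 ℕ.* ∣ q ∣) →
      Decomp (T ∪ H zero) (∣ [ const inside , const outside ]′ σ ∷ p ∣
        ℕ.+ 2 ℕ.* ∣ [ const outside , const inside ]′ σ ∷ q ∣)
    addShape (inj₁ φ) p q D = add edge φ D
    addShape (inj₂ φ) p q D =
      ≡.subst (Decomp (T ∪ H zero)) (≡.sym (+-2* ∣ p ∣ ∣ q ∣)) (add pentagon φ D)

  -- Induced subgraphs without dominated vertices

  -- The failure of both reductions, stated by witnesses: no vertex is isolated in `S`, and no
  -- neighbourhood within `S` is contained in that of another vertex.
  record Irredundant (S : Subset n) : Set where
    field
      neighbour        : ∀ {u} → u ∈ S → ∃[ w ] w ∈ S × Adj u w
      privateNeighbour : ∀ {u v} → u ∈ S → v ∈ S → u ≢ v →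
                         ∃[ w ] w ∈ S × Adj w u × ¬ Adj w v

  Component : Subset n → Set
  Component S = ∃[ s ] Σ[ c ∈ Copy G (graph s) ]
    (∀ i → to c i ∈ S) × (∀ i {w} → w ∈ S → Adj (to c i) w → ∃[ j ] to c j ≡ w)

  module _ (K₃-free : ¬ HasInduced G (K 3)) (P₅-free : ¬ HasInduced G (P 5)) where

    noTriangle : ∀ {x y z} → Adj x y → Adj y z → ¬ Adj x z
    noTriangle {x} {y} {z} xy yz xz = K₃-free (_ , copy⇒≅
      (mkCopy G (K 3) (lookup (x ∷ y ∷ z ∷ [])) (from-yes (twinFree? (K 3)))
        ((xy , xz , _) , (yz , _) , _)))

    noPath : ∀ {a b c d e} → Adj a b → Adj b c → Adj c d → Adj d e →
             ¬ Adj a c → ¬ Adj a d → ¬ Adj a e → ¬ Adj b d → ¬ Adj b e → ¬ Adj c e → ⊥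
    noPath {a} {b} {c} {d} {e} ab bc cd de ac ad ae bd be ce = P₅-free (_ , copy⇒≅
      (mkCopy G (P 5) (lookup (a ∷ b ∷ c ∷ d ∷ e ∷ [])) (from-yes (twinFree? (P 5)))
        ((ab , ac , ad , ae , _) , (bc , bd , be , _) , (cd , ce , _) , (de , _) , _)))

    -- A closed 5-walk; its chords are absent as there are no triangles.
    record Pentagon (a b c d e : Fin n) : Set where
      constructor pent
      field
        ab : Adj a b
        bc : Adj b c
        cd : Adj c d
        de : Adj d e
        ea : Adj e a

    rotate : ∀ {a b c d e} → Pentagon a b c d e → Pentagon b c d e a
    rotate (pent ab bc cd de ea) = pent bc cd de ea ab

    pentagonCopy : ∀ {a b c d e} → Pentagon a b c d e → Copy G C₅
    pentagonCopy {a} {b} {c} {d} {e} (pent ab bc cd de ea) =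
      mkCopy G C₅ (lookup (a ∷ b ∷ c ∷ d ∷ e ∷ [])) (from-yes (twinFree? C₅))
        ( (ab , noTriangle ab bc , noTriangle (symm ea) (symm de) , symm ea , _)
        , (bc , noTriangle bc cd , noTriangle (symm ab) (symm ea) , _)
        , (cd , noTriangle cd de , _) , (de , _) , _)

    -- If `w` missed both `c` and `d`, then `w a b c d` would be an induced path; its remaining
    -- chords are excluded by triangles.
    pentagon-nbr : ∀ {a b c d e w} → Pentagon a b c d e → Adj w a → Adj w c ⊎ Adj w d
    pentagon-nbr {a} {b} {c} {d} {e} {w} (pent ab bc cd de ea) wa with adj? w c | adj? w d
    ... | yes wc | _      = inj₁ wc
    ... | no _   | yes wd = inj₂ wd
    ... | no ¬wc | no ¬wd = ⊥-elim
      (noPath wa ab bc cd (noTriangle wa ab) ¬wc ¬wd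
        (noTriangle ab bc) (noTriangle (symm ea) (symm de)) (noTriangle bc cd))

    module _ {S} (irr : Irredundant S) where
      open Irredundant irr

      -- A private neighbour p of w against b would be adjacent to exactly one
      -- vertex of the pentagon, because w and b are interchangeable in it.
      pentagon-twin : ∀ {a b c d e w} → Pentagon a b c d e → b ∈ S → w ∈ S →
                      Adj w a → Adj w c → b ≡ w
      pentagon-twin {a} {b} {c} {d} {e} {w} pt@(pent ab bc cd de ea) b∈S w∈S wa wc
        with b ≟ w
      ... | yes b≡w = b≡w
      ... | no  b≢w with privateNeighbour w∈S b∈S (b≢w ∘ ≡.sym)
      ...   | p , _ , pw , ¬pb with pentagon-nbr (pent wc cd de ea (symm wa)) pw
      ...     | inj₁ pd = ⊥-elim
        ([ noTriangle pw wa , ¬pb ]′ (pentagon-nbr (rotate (rotate (rotate pt))) pd))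
      ...     | inj₂ pe = ⊥-elim
        ([ ¬pb , noTriangle pw wc ]′ (pentagon-nbr (rotate (rotate (rotate (rotate pt)))) pe))

      -- A neighbour of `a` is also adjacent to `c` or `d`. It then occupies the place of `b`,
      -- between `a` and `c`, or of `e`, between `d` and `a`, and twins coincide.
      pentagon-closed : ∀ {a b c d e w} → Pentagon a b c d e → b ∈ S → e ∈ S → w ∈ S →
                        Adj a w → b ≡ w ⊎ e ≡ w
      pentagon-closed pt b∈S e∈S w∈S aw with pentagon-nbr pt (symm aw)
      ... | inj₁ wc = inj₁ (pentagon-twin pt b∈S w∈S (symm aw) wc)
      ... | inj₂ wd = inj₂ (pentagon-twin (rotate (rotate (rotate pt))) e∈S w∈S wd (symm aw))

      pentagonComponent : ∀ {a b c d e} → Pentagon a b c d e →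
        a ∈ S → b ∈ S → c ∈ S → d ∈ S → e ∈ S → Component S
      pentagonComponent {a} {b} {c} {d} {e} pt a∈ b∈ c∈ d∈ e∈ =
        pentagon , pentagonCopy pt , inS , closed
        where
        v : Fin 5 → Fin n
        v = lookup (a ∷ b ∷ c ∷ d ∷ e ∷ [])

        inS : ∀ i → v i ∈ S
        inS 0F = a∈
        inS 1F = b∈
        inS 2F = c∈
        inS 3F = d∈
        inS 4F = e∈

        pt₁ = rotate pt
        pt₂ = rotate pt₁
        pt₃ = rotate pt₂
        pt₄ = rotate pt₃

        closed : ∀ i {w} → w ∈ S → Adj (v i) w → ∃[ j ] v j ≡ w
        closed 0F w∈ aw = [ 1F ,_ , 4F ,_ ]′ (pentagon-closed pt  b∈ e∈ w∈ aw)
        closed 1F w∈ aw = [ 2F ,_ , 0F ,_ ]′ (pentagon-closed pt₁ c∈ a∈ w∈ aw)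
        closed 2F w∈ aw = [ 3F ,_ , 1F ,_ ]′ (pentagon-closed pt₂ d∈ b∈ w∈ aw)
        closed 3F w∈ aw = [ 4F ,_ , 2F ,_ ]′ (pentagon-closed pt₃ e∈ c∈ w∈ aw)
        closed 4F w∈ aw = [ 0F ,_ , 3F ,_ ]′ (pentagon-closed pt₄ a∈ d∈ w∈ aw)

      -- The private neighbours `a` of `x` and `b` of `z` must be adjacent, as otherwise `a x y z b`
      -- is an induced path.
      cherryComponent : ∀ {x y z} → x ∈ S → y ∈ S → z ∈ S →
                        x ≢ z → Adj x y → Adj y z → Component S
      cherryComponent x∈ y∈ z∈ x≢z xy yz
        with privateNeighbour x∈ z∈ x≢z | privateNeighbour z∈ x∈ (x≢z ∘ ≡.sym)
      ... | a , a∈ , ax , ¬az | b , b∈ , bz , ¬bx with adj? a b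
      ...   | yes ab = pentagonComponent (pent ax xy yz (symm bz) (symm ab)) a∈ x∈ y∈ z∈ b∈
      ...   | no ¬ab = ⊥-elim
        (noPath ax xy yz (symm bz) (noTriangle ax xy) ¬az ¬ab
          (noTriangle xy yz) (¬bx ∘ symm) (noTriangle yz (symm bz)))

      edgeComponent : ∀ {x y} → x ∈ S → y ∈ S → Adj x y →
        (∀ {w} → w ∈ S → Adj x w → y ≡ w) → (∀ {w} → w ∈ S → Adj y w → x ≡ w) → Component S
      edgeComponent {x} {y} x∈ y∈ xy x-closed y-closed =
        edge , mkCopy G (K 2) v (from-yes (twinFree? (K 2))) ((xy , _) , _) , inS , closed
        where
        v : Fin 2 → Fin n
        v = lookup (x ∷ y ∷ [])

        inS : ∀ i → v i ∈ S
        inS 0F = x∈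
        inS 1F = y∈

        closed : ∀ i {w} → w ∈ S → Adj (v i) w → ∃[ j ] v j ≡ w
        closed 0F w∈ xw = 1F , x-closed w∈ xw
        closed 1F w∈ yw = 0F , y-closed w∈ yw

      otherNeighbour? : ∀ x y → Dec (∃[ z ] z ∈ S × x ≢ z × Adj y z)
      otherNeighbour? x y = any? λ z → (z ∈? S) ×-dec ¬? (x ≟ z) ×-dec adj? y z

      component : ∀ {x} → x ∈ S → Component S
      component {x} x∈ with neighbour x∈
      ... | y , y∈ , xy with otherNeighbour? x y | otherNeighbour? y x
      ...   | yes (z , z∈ , x≢z , yz) | _ = cherryComponent x∈ y∈ z∈ x≢z xy yz
      ...   | no _ | yes (z , z∈ , y≢z , xz) = cherryComponent y∈ x∈ z∈ y≢z (symm xy) xz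
      ...   | no ¬y | no ¬x = edgeComponent x∈ y∈ xy
        (λ {w} w∈ xw → decidable-stable (y ≟ w) λ y≢w → ¬x (w , w∈ , y≢w , xw))
        (λ {w} w∈ yw → decidable-stable (x ≟ w) λ x≢w → ¬y (w , w∈ , x≢w , yw))

    -- Removing a component preserves irredundance: every neighbour in `S` of a remaining vertex
    -- remains, so the required witnesses survive.
    irredundant⇒decomp : ∀ {S} → Acc _⊂_ S → Irredundant S → ∃[ k ] Decomp S k
    irredundant⇒decomp {S} (acc rec) irr with nonempty? S
    ... | no  empty-S   = 0 , empty empty-S
    ... | yes (x , x∈S) = remove (component irr x∈S)
      where
      open Irredundant irr

      remove : Component S → ∃[ k ] Decomp S k
      remove (s , c , c∈S , closed) = _ , join s c T⊆S c∈S cover c∉T c≁T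
        (proj₂ (irredundant⇒decomp (rec (T⊆S , to c (c₀ s) , c∈S _ , c∉T _)) irr′))
        where
        T? : Decidable (λ v → v ∈ S × ¬ (∃[ i ] to c i ≡ v))
        T? v = (v ∈? S) ×-dec ¬? (∈image? (to c) v)

        T : Subset n
        T = separate T?

        T⊆S : T ⊆ S
        T⊆S = proj₁ ∘ ∈-separate⁻ T?

        c∉T : ∀ i → to c i ∉ T
        c∉T i c∈T = proj₂ (∈-separate⁻ T? c∈T) (i , ≡.refl)

        c≁T : ∀ i {v} → v ∈ T → ¬ Adj (to c i) v
        c≁T i v∈T cv = proj₂ (∈-separate⁻ T? v∈T) (closed i (T⊆S v∈T) cv)

        cover : ∀ {v} → v ∈ S → v ∈ T ⊎ ∃[ i ] to c i ≡ v
        cover {v} v∈S with ∈image? (to c) v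
        ... | yes v∈c = inj₂ v∈c
        ... | no  v∉c = inj₁ (∈-separate⁺ T? (v∈S , v∉c))

        -- Some vertex of the removed copy, showing that `T` is strictly smaller than `S`.
        c₀ : ∀ s → Fin (order s)
        c₀ edge     = zero
        c₀ pentagon = zero

        stays : ∀ {u w} → u ∈ T → w ∈ S → Adj w u → w ∈ T
        stays u∈T w∈S wu with cover w∈S
        ... | inj₁ w∈T          = w∈T
        ... | inj₂ (i , ≡.refl) = contradiction wu (c≁T i u∈T)

        irr′ : Irredundant T
        irr′ = record
          { neighbour = λ u∈T → let w , w∈S , uw = neighbour (T⊆S u∈T)
              in w , stays u∈T w∈S (symm uw) , uw
          ; privateNeighbour = λ u∈T v∈T u≢v →
              let w , w∈S , wu , ¬wv = privateNeighbour (T⊆S u∈T) (T⊆S v∈T) u≢v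
              in w , stays u∈T w∈S wu , wu , ¬wv
          }

-- Removing and adding one element; maxima over subsets.

∣∖∣ : ∀ {v} {F : Subset n} → v ∈ F → suc ∣ F ∖ v ∣ ≡ ∣ F ∣
∣∖∣ {F = inside  ∷ F} here        = ≡.cong (suc ∘ ∣_∣) (p─⊥≡p F)
∣∖∣ {F = inside  ∷ F} (there v∈F) = ≡.cong suc (∣∖∣ v∈F)
∣∖∣ {F = outside ∷ F} (there v∈F) = ∣∖∣ v∈F

∣∪⁅⁆∣ : ∀ v (F : Subset n) → v ∉ F → ∣ F ∪ ⁅ v ⁆ ∣ ≡ suc ∣ F ∣
∣∪⁅⁆∣ zero    (inside  ∷ F) v∉F = contradiction here v∉F
∣∪⁅⁆∣ zero    (outside ∷ F) v∉F = ≡.cong (suc ∘ ∣_∣) (∪-identityʳ F)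
∣∪⁅⁆∣ (suc v) (inside  ∷ F) v∉F = ≡.cong suc (∣∪⁅⁆∣ v F (v∉F ∘ there))
∣∪⁅⁆∣ (suc v) (outside ∷ F) v∉F = ∣∪⁅⁆∣ v F (v∉F ∘ there)

v∉F∖v : ∀ {v} {F : Subset n} → v ∉ F ∖ v
v∉F∖v {v = suc v} {_ ∷ F} (there p) = v∉F∖v {F = F} p

∈∖⁻ : ∀ {x v} {F : Subset n} → x ∈ F ∖ v → x ∈ F × x ≢ v
∈∖⁻ {v = v} {F} x∈ = p─q⊆p F ⁅ v ⁆ x∈ , λ { ≡.refl → v∉F∖v {F = F} x∈ }

∈∪⁅⁆⁻ : ∀ {x v} {F : Subset n} → x ∈ F ∪ ⁅ v ⁆ → x ∈ F ⊎ x ≡ v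
∈∪⁅⁆⁻ {v = v} {F} x∈ with x∈p∪q⁻ F ⁅ v ⁆ x∈
... | inj₁ x∈F = inj₁ x∈F
... | inj₂ x∈v = inj₂ (x∈⁅y⁆⇒x≡y v x∈v)

v∈F∪⁅v⁆ : ∀ {v} (F : Subset n) → v ∈ F ∪ ⁅ v ⁆
v∈F∪⁅v⁆ {v = v} F = q⊆p∪q F ⁅ v ⁆ (x∈⁅x⁆ v)

-- The number `m` is the largest of the chosen `k`, hence itself one of them, and so it keeps
-- property `P`. The two halves are the subsets with and without the first element.
maximumOverSubsets : ∀ n {P : ℕ → Set} {q} {Q : Subset n → ℕ → Set q} →
  (∀ S → ∃[ k ] P k × Q S k) → ∃[ m ] P m × (∀ S → ∃[ k ] k ≤ m × Q S k)
maximumOverSubsets zero f with f []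
... | k , Pk , Qk = k , Pk , λ { [] → k , ℕ.≤-refl , Qk }
maximumOverSubsets (suc n) f
  with maximumOverSubsets n (f ∘ (inside ∷_)) | maximumOverSubsets n (f ∘ (outside ∷_))
... | i , Pi , fi | o , Po , fo with ℕ.≤-total i o
...   | inj₁ i≤o = o , Po , λ
  { (inside  ∷ S) → let k , k≤i , Qk = fi S in k , ℕ.≤-trans k≤i i≤o , Qk
  ; (outside ∷ S) → fo S }
...   | inj₂ o≤i = i , Pi , λ
  { (inside  ∷ S) → fi S
  ; (outside ∷ S) → let k , k≤o , Qk = fo S in k , ℕ.≤-trans k≤o o≤i , Qk }

-- Independent sets in an edge and in a 5-cycle.

-- A finite check: the evaluated search through all subsets of `Fin 5` finds no independent set that
-- needs more than two vertices to cover it.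
C₅-cover : (A : Subset 5) → (∀ i j → Graph.Adj C₅ i j → i ∈ A → j ∉ A) →
           ∃[ i ] ∃[ j ] ∀ k → k ∈ A → i ≡ k ⊎ j ≡ k
C₅-cover A indep = decidable-stable (covered? A) λ ¬covered →
  from-no (anySubset? λ A → indep? A ×-dec ¬? (covered? A)) (A , indep , ¬covered)
  where
  indep? : ∀ A → Dec (∀ i j → Graph.Adj C₅ i j → i ∈ A → j ∉ A)
  indep? A = all? λ i → all? λ j → Graph.adj? C₅ i j →-dec (i ∈? A →-dec ¬? (j ∈? A))

  covered? : ∀ A → Dec (∃[ i ] ∃[ j ] ∀ k → k ∈ A → i ≡ k ⊎ j ≡ k)
  covered? A = any? λ i → any? λ j → all? λ k → k ∈? A →-dec (i ≟ k ⊎-dec j ≟ k)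

indep-cover : ∀ s (A : Subset (order s)) → (∀ i j → Graph.Adj (graph s) i j → i ∈ A → j ∉ A) →
              Σ[ f ∈ (Fin (weight s) → Fin (order s)) ] ∀ k → k ∈ A → ∃[ i ] f i ≡ k
indep-cover pentagon A indep with C₅-cover A indep
... | i , j , cover = lookup (i ∷ j ∷ []) , λ k k∈A → [ 0F ,_ , 1F ,_ ]′ (cover k k∈A)
indep-cover edge A indep with 0F ∈? A
... | yes 0∈A = (λ _ → 0F) , λ
  { 0F _ → 0F , ≡.refl ; 1F 1∈A → contradiction 1∈A (indep 0F 1F (λ ()) 0∈A) }
... | no  0∉A = (λ _ → 1F) , λ
  { 0F 0∈A → contradiction 0∈A 0∉A ; 1F _ → 0F , ≡.refl }

-- Faces and dimension of the independence complex.

module IndependenceComplex (G : Graph (Fin n)) where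
  open Graph G
  open Decomposition G

  Indep : Subset n → Set
  Indep F = ∀ {u v} → u ∈ F → v ∈ F → ¬ Adj u v

  IsFace : Subset n → Subset n → Set
  IsFace S = SimplicialComplex.IsFace Ind[ G , S ]

  Face : Subset n → ℕ → Subset n → Set
  Face S j F = IsFace S F × ∣ F ∣ ≡ j

  -- Adding to a face a vertex without neighbours in it. The smaller face appears as `F` with `a`
  -- removed, which is the form that `e-supp` asks for.
  insert-face : ∀ {T U F a} → T ⊆ U → a ∈ U → a ∈ F → (∀ {x} → x ∈ F ∖ a → ¬ Adj a x) →
                IsFace T (F ∖ a) → IsFace U F
  insert-face {T} {U} {F} {a} T⊆U a∈U a∈F a≁F (F⊆T , indep) = F⊆U , indep′
    where
    split : ∀ {x} → x ∈ F → x ≡ a ⊎ x ∈ F ∖ a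
    split {x} x∈F with x ≟ a
    ... | yes x≡a = inj₁ x≡a
    ... | no  x≢a = inj₂ (x∈p∧x≢y⇒x∈p-y x∈F x≢a)

    F⊆U : F ⊆ U
    F⊆U x∈F with split x∈F
    ... | inj₁ ≡.refl = a∈U
    ... | inj₂ x∈F∖a  = T⊆U (F⊆T x∈F∖a)

    indep′ : Indep F
    indep′ x∈F y∈F with split x∈F | split y∈F
    ... | inj₁ ≡.refl | inj₁ ≡.refl = irrefl a
    ... | inj₁ ≡.refl | inj₂ y∈     = a≁F y∈
    ... | inj₂ x∈     | inj₁ ≡.refl = a≁F x∈ ∘ symm
    ... | inj₂ x∈     | inj₂ y∈     = indep x∈ y∈

  suc-size : ∀ {F : Subset n} {a j} → a ∈ F → ∣ F ∖ a ∣ ≡ j → ∣ F ∣ ≡ suc j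
  suc-size a∈F p = ≡.trans (≡.sym (∣∖∣ a∈F)) (≡.cong suc p)

  -- Each of the `w` listed vertices accounts for at most one element of `F`. They are taken out in
  -- turn, and what is left is a face within `T`.
  size-bound : ∀ {T} → (∀ {F} → IsFace T F → ∣ F ∣ ≤ k) →
               ∀ w (f : Fin w → Fin n) {F} → Indep F →
               (∀ {x} → x ∈ F → x ∈ T ⊎ ∃[ i ] f i ≡ x) → ∣ F ∣ ≤ w ℕ.+ k
  size-bound bound zero f indep cover =
    bound ((λ x∈F → [ id , (λ ()) ∘ proj₁ ]′ (cover x∈F)) , indep)
  size-bound {k = k} {T} bound (suc w) f {F} indep cover with f zero ∈? F
  ... | yes f₀∈F = ≡.subst (_≤ suc w ℕ.+ k) (∣∖∣ f₀∈F) (s≤s (size-bound bound w (f ∘ suc)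
        (λ x∈ y∈ → indep (proj₁ (∈∖⁻ x∈)) (proj₁ (∈∖⁻ y∈))) cover′))
    where
    cover′ : ∀ {x} → x ∈ F ∖ f zero → x ∈ T ⊎ ∃[ i ] f (suc i) ≡ x
    cover′ x∈ with ∈∖⁻ x∈
    ... | x∈F , x≢f₀ with cover x∈F
    ...   | inj₁ x∈T              = inj₁ x∈T
    ...   | inj₂ (zero  , f₀≡x)   = contradiction (≡.sym f₀≡x) x≢f₀
    ...   | inj₂ (suc i , fᵢ≡x)   = inj₂ (i , fᵢ≡x)
  ... | no  f₀∉F = ℕ.m≤n⇒m≤1+n (size-bound bound w (f ∘ suc) indep cover′)
    where
    cover′ : ∀ {x} → x ∈ F → x ∈ T ⊎ ∃[ i ] f (suc i) ≡ x
    cover′ x∈F with cover x∈F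
    ... | inj₁ x∈T                = inj₁ x∈T
    ... | inj₂ (zero  , ≡.refl)   = contradiction x∈F f₀∉F
    ... | inj₂ (suc i , fᵢ≡x)     = inj₂ (i , fᵢ≡x)

  -- Pulled back along the copy, a face becomes an independent set of `K 2` or `C₅`, so one or two
  -- vertices of the component, respectively, cover it.
  dimension : ∀ {U} → Decomp U k → ∀ {F} → IsFace U F → ∣ F ∣ ≤ k
  dimension (empty U-empty) {F} (F⊆U , _) =
    ℕ.≤-reflexive (≡.trans (≡.cong ∣_∣ (Empty-unique λ (x , x∈F) → U-empty (x , F⊆U x∈F))) (∣⊥∣≡0 n))
  dimension (join {T = T} s c _ _ cover _ _ D) {F} (F⊆U , indep)
    with indep-cover s (separate A?) (λ i j ij i∈A j∈A →
      indep (∈-separate⁻ A? i∈A) (∈-separate⁻ A? j∈A) (adj⁺ c ij))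
    where
    A? : ∀ i → Dec (to c i ∈ F)
    A? i = to c i ∈? F
  ... | f , A⊆f = size-bound (dimension D) (weight s) (to c ∘ f) indep cover′
    where
    cover′ : ∀ {x} → x ∈ F → x ∈ T ⊎ ∃[ i ] to c (f i) ≡ x
    cover′ x∈F with cover (F⊆U x∈F)
    ... | inj₁ x∈T = inj₁ x∈T
    ... | inj₂ (i , ≡.refl) with A⊆f i (∈-separate⁺ (λ i → to c i ∈? F) x∈F)
    ...   | j , ≡.refl = inj₂ (j , ≡.refl)

  -- Vanishing of homology and its behaviour under vertex deletion.

  module WithCoefficients {c ℓ} (R : CommutativeRing c ℓ) where
    open CommutativeRing R hiding (zero)
    open import Algebra.Properties.Ring ring using (-0#≈0#)
    open import Relation.Binary.Reasoning.Setoid setoid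
    open Exterior R
    open Linear

    -- Vanishing of the reduced homology in dimension `j - 1`, with an explicit bounding form for
    -- every cycle.
    Acyclic : Subset n → ℕ → Set (c ⊔ ℓ)
    Acyclic S j = ∀ {z} → Supp (Face S j) z → (∀ F → δ z F ≈ 0#) →
                  Σ[ b ∈ Form n ] Supp (Face S (suc j)) b × δ b ≐ z

    x-0≈x : ∀ {x y} → y ≈ 0# → x - y ≈ x
    x-0≈x y≈0 = trans (+-congˡ (trans (-‿cong y≈0) -0#≈0#)) (+-identityʳ _)

    0-0≈0 : ∀ {x y} → x ≈ 0# → y ≈ 0# → x - y ≈ 0#
    0-0≈0 x≈0 y≈0 = trans (x-0≈x y≈0) x≈0

    -- In the full simplex every cycle bounds its cone. Whether the cone lies in a given complex is
    -- a separate question about supports.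
    δ-e-cycle : ∀ v (z : Form n) → (∀ F → δ z F ≈ 0#) → δ (e v z) ≐ z
    δ-e-cycle v z δz≈0 F = trans (δ-e v _ F) (x-0≈x (homo-0 (e-linear v) δz≈0 F))

    -- The join of the segment `u v` with a cycle: its boundary is the difference of the cones at
    -- the two ends.
    δ-e-e-cycle : ∀ u v (z : Form n) → (∀ F → δ z F ≈ 0#) →
                  ∀ F → δ (e u (e v z)) F ≈ e v z F - e u z F
    δ-e-e-cycle u v z δz≈0 F =
      trans (δ-e u _ F) (+-congˡ (-‿cong (cong (e-linear u) (δ-e-cycle v z δz≈0) F)))

    -- Beyond the dimension there are no faces, so the cycle is zero and the zero form bounds it.
    acyclic-dimension : ∀ {S j} → (∀ {F} → IsFace S F → ∣ F ∣ ≤ k) → k < j → Acyclic S j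
    acyclic-dimension bound k<j z-supp _ = (λ _ → 0#) , (λ _ _ → refl) , λ F →
      trans (homo-0 δ-linear (λ _ → refl) F)
        (sym (z-supp F λ (face , size) → ℕ.<⇒≱ k<j (≡.subst (_≤ _) size (bound face))))

    acyclic-isolated : ∀ {S u j} → u ∈ S → (∀ {w} → w ∈ S → ¬ Adj u w) → Acyclic S j
    acyclic-isolated {S} {u} u∈S u≁S {z} z-supp δz≈0 =
      e u z , e-supp u coned z-supp , δ-e-cycle u z δz≈0
      where
      coned : ∀ {F} → u ∈ F → Face S _ (F ∖ u) → Face S _ F
      coned u∈F (face@(F⊆S , _) , size) =
        insert-face id u∈S u∈F (u≁S ∘ F⊆S) face , suc-size u∈F size

    -- With z₁ = ι v z, the part of z at the link of v, the cycle z is homologous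
    -- to z + (e u - e v) z₁, which avoids v: the difference bounds e v (e u z₁).
    acyclic-dominated : ∀ {S u v j} → u ∈ S → v ∈ S → u ≢ v →
      (∀ {w} → w ∈ S → Adj w u → Adj w v) → Acyclic (S ∖ v) j → Acyclic S j
    acyclic-dominated {S} {u} {v} {j} u∈S v∈S u≢v N[u]⊆N[v] acyclic {z} z-supp δz≈0 =
      let b , b-supp , δb≐y = acyclic y-supp δy≈0 in
      (λ F → b F - e v (e u z₁) F)
      , (λ F ¬face → 0-0≈0 (b-supp F (¬face ∘ weaken)) (e-supp v vu-face u-supp F ¬face))
      , λ F → begin
        δ (λ F → b F - e v (e u z₁) F) F    ≈⟨ homo-‿- δ-linear b _ F ⟩
        δ b F - δ (e v (e u z₁)) F
          ≈⟨ +-cong (δb≐y F) (-‿cong (δ-e-e-cycle v u z₁ δz₁≈0 F)) ⟩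
        (z F + (e u z₁ F - e v z₁ F)) - (e u z₁ F - e v z₁ F)  ≈⟨ +-assoc _ _ _ ⟩
        z F + ((e u z₁ F - e v z₁ F) - (e u z₁ F - e v z₁ F))  ≈⟨ +-congˡ (-‿inverseʳ _) ⟩
        z F + 0#                                               ≈⟨ +-identityʳ _ ⟩
        z F                                                    ∎
      where
      z₁ y : Form n
      z₁ = ι v z
      y F = z F + (e u z₁ F - e v z₁ F)

      -- Faces of the link of `v` with `j - 1` elements. Writing `suc ∣ F ∣ ≡ j` avoids a
      -- predecessor and leaves no such faces when `j` is 0.
      Link : Subset n → Set
      Link F = (∀ {x} → x ∈ F → ¬ Adj v x) × IsFace (S ∖ v) F × suc ∣ F ∣ ≡ j

      S∖v⊆S : S ∖ v ⊆ S
      S∖v⊆S = p─q⊆p S ⁅ v ⁆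

      weaken : ∀ {i F} → Face (S ∖ v) i F → Face S i F
      weaken ((F⊆S , indep) , size) = ((S∖v⊆S ∘ F⊆S) , indep) , size

      link : ∀ {F} → v ∉ F → Face S j (F ∪ ⁅ v ⁆) → Link F
      link {F} v∉F ((F⊆S , indep) , size) =
        (λ x∈F → indep (v∈F∪⁅v⁆ F) (p⊆p∪q ⁅ v ⁆ x∈F))
        , ((λ x∈F → x∈p∧x≢y⇒x∈p-y (F⊆S (p⊆p∪q ⁅ v ⁆ x∈F)) λ { ≡.refl → v∉F x∈F })
          , λ x∈F y∈F → indep (p⊆p∪q ⁅ v ⁆ x∈F) (p⊆p∪q ⁅ v ⁆ y∈F))
        , ≡.trans (≡.sym (∣∪⁅⁆∣ v F v∉F)) size

      z₁-supp : Supp Link z₁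
      z₁-supp = ι-supp v link z-supp

      UFace : Subset n → Set
      UFace F = Face (S ∖ v) j F × u ∈ F × Link (F ∖ u)

      -- A face of the link contains no neighbour of `v`, hence by domination none of `u`, so `u`
      -- can be added. The link condition is kept because `v` is added next.
      u-face : ∀ {F} → u ∈ F → Link (F ∖ u) → UFace F
      u-face u∈F l@(v≁F , face@(F⊆S , _) , size) =
        ( insert-face id (x∈p∧x≢y⇒x∈p-y u∈S u≢v) u∈F
            (λ x∈F ux → v≁F x∈F (symm (N[u]⊆N[v] (S∖v⊆S (F⊆S x∈F)) (symm ux)))) face
        , ≡.trans (≡.sym (∣∖∣ u∈F)) size )
        , u∈F , l

      u-supp : Supp UFace (e u z₁)
      u-supp = e-supp u u-face z₁-supp

      v≁u : ¬ Adj v u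
      v≁u vu = irrefl v (N[u]⊆N[v] v∈S vu)

      vu-face : ∀ {F} → v ∈ F → UFace (F ∖ v) → Face S (suc j) F
      vu-face {F} v∈F ((face , size) , u∈F , v≁F , _) =
        insert-face S∖v⊆S v∈S v∈F v≁ face , suc-size v∈F size
        where
        v≁ : ∀ {x} → x ∈ F ∖ v → ¬ Adj v x
        v≁ {x} x∈F with x ≟ u
        ... | yes ≡.refl = v≁u
        ... | no  x≢u    = v≁F (x∈p∧x≢y⇒x∈p-y x∈F x≢u)

      δz₁≈0 : ∀ F → δ z₁ F ≈ 0#
      δz₁≈0 F = trans (δ-ι v z F) (-x≈0 (homo-0 (ι-linear v) δz≈0 F))

      δy≈0 : ∀ F → δ y F ≈ 0#
      δy≈0 F = begin
        δ y F                                        ≈⟨ homo-+ δ-linear z _ F ⟩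
        δ z F + δ (λ F → e u z₁ F - e v z₁ F) F
          ≈⟨ +-cong (δz≈0 F) (homo-‿- δ-linear (e u z₁) _ F) ⟩
        0# + (δ (e u z₁) F - δ (e v z₁) F)           ≈⟨ +-identityˡ _ ⟩
        δ (e u z₁) F - δ (e v z₁) F
          ≈⟨ +-cong (δ-e-cycle u z₁ δz₁≈0 F) (-‿cong (δ-e-cycle v z₁ δz₁≈0 F)) ⟩
        z₁ F - z₁ F                                  ≈⟨ -‿inverseʳ _ ⟩
        0#                                           ∎

      y-supp : Supp (Face (S ∖ v) j) y
      y-supp F ¬face with v ∈? F
      -- On sets containing `v`, the term `e v z₁` is exactly `z` and cancels it, while `e u z₁` is
      -- supported on sets avoiding `v`.
      ... | yes v∈F = begin
        z F + (e u z₁ F - e v z₁ F)  ≈⟨ +-congˡ (+-cong e-u≈0 (-‿cong (e-ι z v∈F))) ⟩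
        z F + (0# - z F)             ≈⟨ +-congˡ (+-identityˡ _) ⟩
        z F - z F                    ≈⟨ -‿inverseʳ _ ⟩
        0#                           ∎
        where e-u≈0 = u-supp F (¬face ∘ proj₁)
      ... | no v∉F = begin
        z F + (e u z₁ F - e v z₁ F)
          ≈⟨ +-cong (z-supp F ¬face′) (0-0≈0 (u-supp F (¬face ∘ proj₁)) (e-∉ v z₁ v∉F)) ⟩
        0# + 0#                      ≈⟨ +-identityˡ _ ⟩
        0#                           ∎
        where
        ¬face′ : ¬ Face S j F
        ¬face′ ((F⊆S , indep) , size) = ¬face
          (((λ x∈F → x∈p∧x≢y⇒x∈p-y (F⊆S x∈F) λ { ≡.refl → v∉F x∈F }) , indep) , size)

    EventuallyAcyclic : Subset n → ℕ → Set (c ⊔ ℓ)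
    EventuallyAcyclic S k = ∀ {j} → k < j → Acyclic S j

    isolated? : ∀ S → Dec (∃[ u ] u ∈ S × (∀ w → w ∈ S → ¬ Adj u w))
    isolated? S = any? λ u → (u ∈? S) ×-dec (all? λ w → w ∈? S →-dec ¬? (adj? u w))

    dominated? : ∀ S → Dec (∃[ u ] ∃[ v ] u ∈ S × v ∈ S × u ≢ v ×
                            (∀ w → w ∈ S → Adj w u → Adj w v))
    dominated? S = any? λ u → any? λ v → (u ∈? S) ×-dec (v ∈? S) ×-dec ¬? (u ≟ v) ×-dec
      (all? λ w → w ∈? S →-dec (adj? w u →-dec adj? w v))

    module _ (K₃-free : ¬ HasInduced G (K 3)) (P₅-free : ¬ HasInduced G (P 5)) where

      -- Induction on `S` by deleting dominated vertices. The bound passes unchanged from the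
      -- smaller set, since a family found there is already a family in `G`.
      eventuallyAcyclic : ∀ {S} → Acc _⊂_ S → ∃[ k ] IsFamilyValue G k × EventuallyAcyclic S k
      eventuallyAcyclic {S} (acc rec) with isolated? S | dominated? S
      -- A cone is acyclic in every degree, so the value 0 of the empty family is enough.
      ... | yes (u , u∈S , u≁S) | _ =
        0 , (proj₁ none , proj₁ (proj₂ none)) , λ _ → acyclic-isolated u∈S (λ {w} → u≁S w)
        where none = decomp⇒family (empty {U = ∅} (∉⊥ ∘ proj₂))
      ... | no _ | yes (u , v , u∈S , v∈S , u≢v , N[u]⊆N[v]) =
        let k , value , ac = eventuallyAcyclic (rec (x∈p⇒p-x⊂p v∈S))
        in k , value , λ k<j → acyclic-dominated u∈S v∈S u≢v (λ {w} → N[u]⊆N[v] w) (ac k<j)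
      ... | no ¬isolated | no ¬dominated =
        let k , D = irredundant⇒decomp K₃-free P₅-free (⊂-wellFounded S) irredundant
            𝓗 , value≡k , _ = decomp⇒family D
        in k , (𝓗 , value≡k) , acyclic-dimension (dimension D)
        where
        irredundant : Irredundant S
        irredundant = record
          { neighbour = λ {u} u∈S →
              decidable-stable (any? λ w → (w ∈? S) ×-dec adj? u w) λ none →
                ¬isolated (u , u∈S , λ w w∈S uw → none (w , w∈S , uw))
          ; privateNeighbour = λ {u} {v} u∈S v∈S u≢v →
              decidable-stable (any? λ w → (w ∈? S) ×-dec adj? w u ×-dec ¬? (adj? w v)) λ none →
                ¬dominated (u , v , u∈S , v∈S , u≢v , λ w w∈S wu →
                  decidable-stable (adj? w v) λ ¬wv → none (w , w∈S , wu , ¬wv))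
          }

    -- The fundamental cycle of a disjoint union of edges and 5-cycles

    record TopCycle (U : Subset n) (k : ℕ) : Set (c ⊔ ℓ) where
      field
        cycle   : Form n
        supp    : Supp (Face U k) cycle
        closed  : ∀ F → δ cycle F ≈ 0#
        nonzero : ¬ (∀ F → cycle F ≈ 0#)

    ∉-∪ : ∀ {x v} {F : Subset n} → x ∉ F → x ≢ v → x ∉ F ∪ ⁅ v ⁆
    ∉-∪ x∉F x≢v x∈ = [ x∉F , x≢v ]′ (∈∪⁅⁆⁻ x∈)

    -- Induction over the components: the cycle on `T` is multiplied by a difference of two points
    -- for an edge, and by a 1-cycle of five segments for a 5-cycle.
    topCycle : ¬ (1# ≈ 0#) → ∀ {U} → Decomp U k → TopCycle U k
    topCycle 1≉0 (empty U-empty) = record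
      { cycle   = z
      ; supp    = z-supp
      ; closed  = δz≈0
      ; nonzero = λ z≈0 → 1≉0 (trans (z∅ n) (z≈0 ∅))
      }
      where
      -- Coefficient 1 at the empty face, the generator in dimension -1, and 0 elsewhere.
      z : ∀ {n} → Form n
      z []            = 1#
      z (inside  ∷ F) = 0#
      z (outside ∷ F) = z F

      z∅ : ∀ n → 1# ≈ z (∅ {n})
      z∅ zero    = refl
      z∅ (suc n) = z∅ n

      δz≈0 : ∀ {n} (F : Subset n) → δ z F ≈ 0#
      δz≈0 []            = refl
      δz≈0 (inside  ∷ F) = -x≈0 (homo-0 δ-linear (λ _ → refl) F)
      δz≈0 (outside ∷ F) = trans (+-identityˡ _) (δz≈0 F)

      z-nonempty : ∀ {n} {F : Subset n} → Nonempty F → z F ≈ 0#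
      z-nonempty {F = inside  ∷ F} _                  = refl
      z-nonempty {F = outside ∷ F} (suc x , there x∈F) = z-nonempty (x , x∈F)

      z-supp : Supp (Face _ 0) z
      z-supp F ¬face with nonempty? F
      ... | yes nonempty-F = z-nonempty nonempty-F
      ... | no  empty-F    = ⊥-elim (¬face
        (((λ x∈F → ⊥-elim (empty-F (_ , x∈F))) , (λ u∈F → ⊥-elim (empty-F (_ , u∈F))))
        , ≡.trans (≡.cong ∣_∣ (Empty-unique empty-F)) (∣⊥∣≡0 n)))
    topCycle 1≉0 (join {k = k} {T = T} {U = U} s κ T⊆U κ∈U cover κ∉T κ≁T D) = step s κ κ∈U κ∉T κ≁T
      where
      open TopCycle (topCycle 1≉0 D) renaming (cycle to z)

      z-∌ : ∀ {x F} → x ∉ T → x ∈ F → z F ≈ 0#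
      z-∌ x∉T x∈F = supp _ λ ((F⊆T , _) , _) → x∉T (F⊆T x∈F)

      step : ∀ s (κ : Copy G (graph s)) → (∀ i → to κ i ∈ U) → (∀ i → to κ i ∉ T) →
             (∀ i {x} → x ∈ T → ¬ Adj (to κ i) x) → TopCycle U (weight s ℕ.+ k)
      step edge κ κ∈U κ∉T κ≁T = record
        { cycle   = λ F → e a z F - e b z F
        ; supp    = λ F ¬face →
            0-0≈0 (e-supp a (face 0F) supp F ¬face) (e-supp b (face 1F) supp F ¬face)
        ; closed  = λ F → trans (homo-‿- δ-linear (e a z) (e b z) F)
            (trans (+-cong (δ-e-cycle a z closed F) (-‿cong (δ-e-cycle b z closed F))) (-‿inverseʳ _))
        ; nonzero = λ z′≈0 → nonzero (z≈0 z′≈0)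
        }
        where
        a = to κ 0F
        b = to κ 1F

        face : ∀ i {F} → to κ i ∈ F → Face T k (F ∖ to κ i) → Face U (suc k) F
        face i i∈F (face@(F⊆T , _) , size) =
          insert-face T⊆U (κ∈U i) i∈F (κ≁T i ∘ F⊆T) face , suc-size i∈F size

        z≈0 : (∀ F → e a z F - e b z F ≈ 0#) → ∀ F → z F ≈ 0#
        z≈0 z′≈0 F with a ∈? F | b ∈? F
        ... | yes a∈F | _       = z-∌ (κ∉T 0F) a∈F
        ... | no _    | yes b∈F = z-∌ (κ∉T 1F) b∈F
        -- At `F ∪ ⁅ a ⁆` the term `e b z` vanishes, and `e a z` has the value `± z F`.
        ... | no a∉F  | no b∉F  = e-∪ a z F a∉F
          (trans (sym (x-0≈x (e-∉ b z (∉-∪ b∉F (λ b≡a → contradiction (injective κ b≡a) λ ())))))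
            (z′≈0 (F ∪ ⁅ a ⁆)))
      step pentagon κ κ∈U κ∉T κ≁T = record
        { cycle   = z′
        ; supp    = λ F ¬face → sum≈0
            (f-supp 0F 2F (λ { (inj₁ ()) ; (inj₂ ()) }) F ¬face)
            (f-supp 2F 4F (λ { (inj₁ ()) ; (inj₂ ()) }) F ¬face)
            (f-supp 4F 1F (λ { (inj₁ ()) ; (inj₂ ()) }) F ¬face)
            (f-supp 1F 3F (λ { (inj₁ ()) ; (inj₂ ()) }) F ¬face)
            (f-supp 3F 0F (λ { (inj₁ ()) ; (inj₂ ()) }) F ¬face)
        ; closed  = δz′≈0
        ; nonzero = λ z′≈0 → nonzero (z≈0 z′≈0)
        }
        where
        E : Fin 5 → Form n
        E i = e (to κ i) z

        f : Fin 5 → Fin 5 → Form n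
        f i j = e (to κ i) (E j)

        -- The independence complex of C₅ is the 5-cycle 0 2 4 1 3.
        z′ : Form n
        z′ F = f 0F 2F F + (f 2F 4F F + (f 4F 1F F + (f 1F 3F F + f 3F 0F F)))

        sum≈0 : ∀ {x₀ x₁ x₂ x₃ x₄} → x₀ ≈ 0# → x₁ ≈ 0# → x₂ ≈ 0# → x₃ ≈ 0# → x₄ ≈ 0# →
                x₀ + (x₁ + (x₂ + (x₃ + x₄))) ≈ 0#
        sum≈0 p₀ p₁ p₂ p₃ p₄ = 0+0 p₀ (0+0 p₁ (0+0 p₂ (0+0 p₃ p₄)))
          where
          0+0 : ∀ {x y} → x ≈ 0# → y ≈ 0# → x + y ≈ 0#
          0+0 x≈0 y≈0 = trans (+-cong x≈0 y≈0) (+-identityˡ 0#)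

        -- Two nonadjacent vertices of the 5-cycle extend a face of `T`. `Face₁` records where its
        -- elements come from, so that the second insertion can check nonadjacency.
        f-supp : ∀ i j → ¬ Graph.Adj C₅ i j → Supp (Face U (2 ℕ.+ k)) (f i j)
        f-supp i j i≁j = e-supp (to κ i) face₂ (e-supp (to κ j) face₁ supp)
          where
          Face₁ : Subset n → Set
          Face₁ F = Face U (suc k) F × (∀ {x} → x ∈ F → x ≡ to κ j ⊎ x ∈ T)

          face₁ : ∀ {F} → to κ j ∈ F → Face T k (F ∖ to κ j) → Face₁ F
          face₁ {F} j∈F (face@(F⊆T , _) , size) =
            (insert-face T⊆U (κ∈U j) j∈F (κ≁T j ∘ F⊆T) face , suc-size j∈F size) , split
            where
            split : ∀ {x} → x ∈ F → x ≡ to κ j ⊎ x ∈ T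
            split {x} x∈F with x ≟ to κ j
            ... | yes x≡j = inj₁ x≡j
            ... | no  x≢j = inj₂ (F⊆T (x∈p∧x≢y⇒x∈p-y x∈F x≢j))

          face₂ : ∀ {F} → to κ i ∈ F → Face₁ (F ∖ to κ i) → Face U (2 ℕ.+ k) F
          face₂ {F} i∈F ((face , size) , split) =
            insert-face id (κ∈U i) i∈F i≁F face , suc-size i∈F size
            where
            i≁F : ∀ {x} → x ∈ F ∖ to κ i → ¬ Adj (to κ i) x
            i≁F x∈F with split x∈F
            ... | inj₁ ≡.refl = i≁j ∘ adj⁻ κ
            ... | inj₂ x∈T    = κ≁T i x∈T

        telescope : ∀ a b c → (b - a) + (c - b) ≈ c - a
        telescope a b c = begin
          (b - a) + (c - b)    ≈⟨ +-comm _ _ ⟩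
          (c - b) + (b - a)    ≈⟨ +-assoc _ _ _ ⟩
          c + (- b + (b - a))  ≈⟨ +-congˡ (+-assoc _ _ _) ⟨
          c + ((- b + b) - a)  ≈⟨ +-congˡ (+-congʳ (-‿inverseˡ _)) ⟩
          c + (0# - a)         ≈⟨ +-congˡ (+-identityˡ _) ⟩
          c - a                ∎

        δf : ∀ i j F → δ (f i j) F ≈ E j F - E i F
        δf i j = δ-e-e-cycle (to κ i) (to κ j) z closed

        δz′≈0 : ∀ F → δ z′ F ≈ 0#
        -- The boundaries `E j - E i` telescope along the closed walk 0 2 4 1 3 0, leaving
        -- `E 0F - E 0F`.
        δz′≈0 F =
          trans (homo-+ δ-linear (f 0F 2F) _ F)           (trans (+-cong (δf 0F 2F F)
          (trans (homo-+ δ-linear (f 2F 4F) _ F)          (trans (+-cong (δf 2F 4F F)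
          (trans (homo-+ δ-linear (f 4F 1F) _ F)          (trans (+-cong (δf 4F 1F F)
          (trans (homo-+ δ-linear (f 1F 3F) (f 3F 0F) F)  (trans (+-cong (δf 1F 3F F) (δf 3F 0F F))
            (telescope _ _ _))))
            (telescope _ _ _))))
            (telescope _ _ _))))
            (trans (telescope _ _ _) (-‿inverseʳ _)))

        f-∉ : ∀ i j {F} → to κ j ∉ F → f i j F ≈ 0#
        f-∉ i j j∉F = e-∈ (to κ i) _ _ (e-∉ (to κ j) z (j∉F ∘ proj₁ ∘ ∈∖⁻))

        z≈0 : (∀ F → z′ F ≈ 0#) → ∀ F → z F ≈ 0#
        z≈0 z′≈0 F with any? (λ i → to κ i ∈? F)
        ... | yes (i , i∈F) = z-∌ (κ∉T i) i∈F
        -- The set `F′` adds just the vertices 0 and 2 of the 5-cycle to `F`. Only `f 0F 2F`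
        -- survives there, with value `± z F`, and the two multiplications are undone one after the
        -- other.
        ... | no  κ∉F = e-∪ (to κ 2F) z F (κ∉ 2F) (e-∪ (to κ 0F) (E 2F) (F ∪ ⁅ to κ 2F ⁆)
            (∉-∪ (κ∉ 0F) (to-≢ 0F 2F λ ()))
            (trans (sym (trans (+-congˡ rest≈0) (+-identityʳ _))) (z′≈0 F′)))
          where
          κ∉ : ∀ i → to κ i ∉ F
          κ∉ i i∈F = κ∉F (i , i∈F)

          to-≢ : ∀ i j → i ≢ j → to κ i ≢ to κ j
          to-≢ i j i≢j = i≢j ∘ injective κ

          F′ = (F ∪ ⁅ to κ 2F ⁆) ∪ ⁅ to κ 0F ⁆

          κ∉′ : ∀ i → i ≢ 2F → i ≢ 0F → to κ i ∉ F′
          κ∉′ i i≢2 i≢0 = ∉-∪ (∉-∪ (κ∉ i) (to-≢ i 2F i≢2)) (to-≢ i 0F i≢0)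

          rest≈0 : f 2F 4F F′ + (f 4F 1F F′ + (f 1F 3F F′ + f 3F 0F F′)) ≈ 0#
          rest≈0 = trans (sym (+-identityˡ _)) (sum≈0 refl
            (f-∉ 2F 4F (κ∉′ 4F (λ ()) (λ ())))
            (f-∉ 4F 1F (κ∉′ 1F (λ ()) (λ ())))
            (f-∉ 1F 3F (κ∉′ 3F (λ ()) (λ ())))
            -- The inner vertex `0F` does lie in `F′`, so this term vanishes through its outer
            -- vertex instead.
            (e-∉ (to κ 3F) (E 0F) (κ∉′ 3F (λ ()) (λ ()))))

    -- Translation to simplicial homology.

    acyclic⇒¬H̃ : ∀ {S j} → Acyclic S j → ¬ Homology.H̃[_-1]≢0 R Ind[ G , S ] j
    acyclic⇒¬H̃ {S} {j} acyclic (z , z-cycle , z-¬boundary) =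
      let b , b-supp , δb≐z = acyclic (supported z) (λ F → trans (sym (∂≈δ X z F)) (z-cycle F))
          b′ = record { coeff = b ; supported = b-supp }
      in z-¬boundary (b′ , λ F → trans (∂≈δ X b′ F) (δb≐z F))
      where
      X = Ind[ G , S ]
      open Homology R X using (coeff; supported)

    -- By `dimension` no face has `suc k` elements, so a chain bounding the cycle would be zero and
    -- force the cycle to be zero.
    decomp⇒H̃ : ¬ (1# ≈ 0#) → ∀ {U} → Decomp U k → Homology.H̃[_-1]≢0 R Ind[ G , U ] k
    decomp⇒H̃ 1≉0 {U} D = z , (λ F → trans (∂≈δ X z F) (closed F)) , λ (b , ∂b≈z) →
      nonzero λ F → trans (sym (∂b≈z F)) (trans (∂≈δ X b F) (homo-0 δ-linear (vanishes b) F))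
      where
      X = Ind[ G , U ]
      open Homology R X using (Chain; coeff; supported)
      open TopCycle (topCycle 1≉0 D)

      z : Chain _
      z = record { coeff = cycle ; supported = supp }

      vanishes : (b : Chain _) → ∀ F → coeff b F ≈ 0#
      vanishes b F = supported b F λ (face , size) →
        ℕ.<⇒≱ ℕ.≤-refl (≡.subst (_≤ _) size (dimension D face))

-- Regularity as the largest family value.

mainTheorem5 : ∀ {c ℓ₁ ℓ₂} (𝕜 : HeytingField c ℓ₁ ℓ₂) (n : ℕ) (G : Graph (Fin n)) →
    ¬ HasInduced G (K 3) →
    ¬ HasInduced G (P 5) →
    ∃[ m ] (IsReg 𝕜 G m × IsMaximum (IsFamilyValue G) m)
mainTheorem5 𝕜 n G K₃-free P₅-free =
  let m , m-value , bounds = maximumOverSubsets n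
        (λ S → eventuallyAcyclic K₃-free P₅-free (⊂-wellFounded S))
      reg≤m : ∀ {j} → ∃[ S ] Homology.H̃[_-1]≢0 R Ind[ G , S ] j → j ≤ m
      reg≤m = λ (S , H̃≢0) → let k , k≤m , acyclic = bounds S in
        ℕ.≮⇒≥ λ m<j → acyclic⇒¬H̃ (acyclic (ℕ.≤-<-trans k≤m m<j)) H̃≢0
  -- Every family value is a degree with nonzero homology, so the bound on these degrees also bounds
  -- the values. Since `m` is itself a family value, both maxima are attained.
  in m , (value⇒H̃ m-value , reg≤m) , (m-value , λ v → reg≤m (value⇒H̃ v))
  where
  open HeytingField 𝕜 using (heytingCommutativeRing; #-irrefl; _≈_; 1#; 0#)
  R = HeytingCommutativeRing.commutativeRing heytingCommutativeRing
  open Decomposition G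
  open IndependenceComplex G
  open WithCoefficients R

  1≉0 : ¬ (1# ≈ 0#)
  1≉0 1≈0 = #-irrefl 1≈0 (HeytingProperties.1#0 heytingCommutativeRing)

  value⇒H̃ : ∀ {j} → IsFamilyValue G j → ∃[ S ] Homology.H̃[_-1]≢0 R Ind[ G , S ] j
  value⇒H̃ (𝓗 , ≡.refl) =
    let U , D , _ = family⇒decomp r H shape disjoint nonadjacent in U , decomp⇒H̃ 1≉0 D
    where open Family 𝓗
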